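{- Let $(P,e)$ be a tree pattern with $P\in\mathcal{T}_k$, and let $\sigma(P,e)=(\tau(P),C)$ be the mesh pattern defined below. Then for every $n\ge 0$, the preorder map $\tau$ restricts to a bijection $\tau\colon \mathcal{T}_n(P,e)\to S_n(231,\sigma(P,e))$, where $S_n(231,\sigma(P,e))$ is the set of permutations of $[n]$ that avoid both the classical pattern $231$ and the mesh pattern $\sigma(P,e)$.
   Context: For $n\ge 0$, $\mathcal{T}_n$ is the set of binary trees with $n$ vertices (every vertex has at most one left and at most one right child), with vertices labeled $1,\dots,n$ by the search tree property (vertices in the left subtree of $i$ are smaller than $i$, those in its right subtree larger); $\mathcal{T}_0=\{\varepsilon\}$. For a vertex $i$: $c_L(i),c_R(i),p(i)$ denote its left child, right child, parent ($\varepsilon$ if nonexistent); $r(T)$ is the root; $T(i)$ is the subtree rooted at $i$; $L(i),R(i)$ are the subtrees rooted at $c_L(i),c_R(i)$ (empty if that child does not exist); $L(T)=L(r(T))$, $R(T)=R(r(T))$. $B_R(i)=\{i,c_R(i),c_R^2(i),\dots\}$ is the set of vertices of the right branch starting at $i$ (following right children as long as they exist), and $B_R^-(i)$ is $B_R(i)$ with its last (lowest) vertex removed. A tree pattern is a pair $(P,e)$ with $P\in\mathcal{T}_k$ and $e\colon[k]\setminus\{r(P)\}\to\{0,1\}$. A tree $T\in\mathcal{T}_n$ contains $(P,e)$ if there is an injection $f\colon[k]\to[n]$ such that for every non-root vertex $i$ of $P$: if $e(i)=1$, then $f(i)$ is the left (resp. right) child of $f(p(i))$ in $T$ when $i$ is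 the left (resp. right) child of $p(i)$ in $P$; if $e(i)=0$, then $f(i)\in L(f(p(i)))$ (resp. $f(i)\in R(f(p(i)))$) when $i$ is the left (resp. right) child of $p(i)$. Otherwise $T$ avoids $(P,e)$; $\mathcal{T}_n(P,e)$ is the set of $T\in\mathcal{T}_n$ avoiding $(P,e)$. The preorder permutation is defined by $\tau(\varepsilon)=$ empty and $\tau(T)=(r(T),\tau(L(T)),\tau(R(T)))$. Mesh patterns: for $\pi\in S_n$ let $G(\pi)=\{(i,\pi(i)):i\in[n]\}$. A mesh pattern is $(\tau,C)$ with $\tau\in S_k$, $C\subseteq\{0,\dots,k\}^2$. A permutation $\pi\in S_n$ contains $(\tau,C)$ if there are indices $\nu_1<\dots<\nu_k$ such that $\pi(\nu_1),\dots,\pi(\nu_k)$ are in the same relative order as $\tau$, and, letting $\lambda_1<\dots<\lambda_k$ be these values sorted, with $\nu_0=\lambda_0=0$, $\nu_{k+1}=\lambda_{k+1}=n+1$, we have $G(\pi)\cap\big((\nu_i,\nu_{i+1})\times(\lambda_j,\lambda_{j+1})\big)=\emptyset$ for all $(i,j)\in C$. Classical pattern containment is the case $C=\emptyset$. Definition of $\sigma(P,e)$: let $\rho=\tau(P)^{ -1}$. For $i\in[k]$ let $C_i=\{(\rho(i)-1,j): j\in B_R^-(i)\}$; for $i\in[k]\setminus\{r(P)\}$ let $C_i'=\emptyset$ if $e(i)=0$ and $C_i'=\{(\rho(i)-1,\min P(i)-1),(\rho(i)-1,\max P(i))\}$ if $e(i)=1$, where $\min P(i),\max P(i)$ are the smallest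 and largest vertex labels in the subtree $P(i)$. Then $\sigma(P,e)=\big(\tau(P),\bigcup_{i\in[k]}C_i\cup\bigcup_{i\in[k]\setminus\{r(P)\}}C_i'\big)$. -}

module Defs where

open import Data.Bool.Base using (Bool; true; false)
open import Data.Fin.Base using (Fin; zero; suc; toℕ; fromℕ; inject₁; cast; punchOut; _<_; _≤_)
open import Data.Fin.Patterns using (0F; 1F; 2F)
open import Data.Fin.Permutation using (Permutation′; permutation; _⟨$⟩ʳ_; _⟨$⟩ˡ_)
open import Data.Fin.Properties using (any?; _≟_; punchOut-injective; injective⇒≤; <-irrefl; <-trans; cast-involutive)
open import Data.List.Base using (List; []; _∷_; _++_; length; lookup)
open import Data.List.Membership.Propositional using (_∈_)
open import Data.List.Membership.Propositional.Properties using (∈-++⁻; ∈-lookup)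
open import Data.List.Properties using (length-++)
open import Data.List.Relation.Unary.All using (tabulate)
import Data.List.Relation.Unary.All as All
open import Data.List.Relation.Unary.Any using (here; there)
open import Data.List.Relation.Unary.AllPairs using ([]; _∷_)
open import Data.List.Relation.Unary.Unique.Propositional using (Unique)
open import Data.List.Relation.Unary.Unique.Propositional.Properties using (++⁺)
open import Data.Maybe.Base using (Maybe; just; nothing)
open import Data.Nat.Base using (ℕ; suc; _+_)
import Data.Nat.Base as ℕ
open import Data.Nat.Properties using (+-suc; 1+n≰n)
open import Data.Product.Base using (Σ-syntax; ∃-syntax; _×_; _,_; proj₁; proj₂; map)
open import Data.Refinement using (Refinement-syntax; value)
open import Data.Sum.Base using (_⊎_; inj₁; inj₂)
open import Data.Tree.Binary using (Tree; leaf; node; #nodes)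
open import Data.Unit.Base using (⊤; tt)
open import Data.Vec.Functional using (Vector; insertAt) renaming (_∷_ to _∷ᵛ_)
open import Function.Base using (_∘_; _on_)
open import Function.Bundles using (_⇔_)
open import Function.Definitions using (Injective)
open import Function.Structures using (IsBijection)
open import Level using (0ℓ)
open import Relation.Binary.Core using (Rel)
open import Relation.Binary.Definitions using (Monotonic₁)
open import Relation.Binary.PropositionalEquality using (_≡_; _≢_; refl; sym; trans; cong)
open import Relation.Nullary using (¬_; yes; no; contradiction)
open import Relation.Unary using (Pred; ∅; _∪_; ⋃)

private
  variable
    A : Set
    k n : ℕ

-- Throughout, [n] = {1,…,n} is represented by Fin n, the element i : Fin n
-- standing for suc (toℕ i).

BinTree : Set → Set
BinTree A = Tree A ⊤

pattern ε = leaf tt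

infix 4 _∈ᵛ_ _⊑_

data _∈ᵛ_ {A : Set} (v : A) : BinTree A → Set where
  root  : ∀ {l r} → v ∈ᵛ node l v r
  left  : ∀ {l i r} → v ∈ᵛ l → v ∈ᵛ node l i r
  right : ∀ {l i r} → v ∈ᵛ r → v ∈ᵛ node l i r

-- s ⊑ t: s is t itself, or the (possibly empty) left or right subtree of
-- some vertex of t.
data _⊑_ {A : Set} (s : BinTree A) : BinTree A → Set where
  self  : s ⊑ s
  left  : ∀ {l i r} → s ⊑ l → s ⊑ node l i r
  right : ∀ {l i r} → s ⊑ r → s ⊑ node l i r

rootOf : BinTree A → Maybe A
rootOf ε            = nothing
rootOf (node _ i _) = just i

IsSearchTree : BinTree (Fin n) → Set
IsSearchTree t = ∀ {l i r} → node l i r ⊑ t →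
  (∀ {v} → v ∈ᵛ l → v < i) × (∀ {v} → v ∈ᵛ r → i < v)

record 𝒯 (n : ℕ) : Set where
  field
    tree         : BinTree (Fin n)
    isSearchTree : IsSearchTree tree
    size         : #nodes tree ≡ n

open 𝒯 public

infix 4 _≈ᵀ_

_≈ᵀ_ : Rel (𝒯 n) 0ℓ
_≈ᵀ_ = _≡_ on tree

-- Vertex labels are distinct, so in the following relations T and i
-- determine the subtrees l, r, s, and the child c.

LeftChild RightChild : 𝒯 n → Fin n → Fin n → Set
LeftChild  T i c = ∃[ a ] ∃[ b ] ∃[ r ] node (node a c b) i r ⊑ tree T
RightChild T i c = ∃[ l ] ∃[ a ] ∃[ b ] node l i (node a c b) ⊑ tree T

InL InR : 𝒯 n → Fin n → Fin n → Set
InL T i v = ∃[ l ] ∃[ r ] node l i r ⊑ tree T × v ∈ᵛ l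
InR T i v = ∃[ l ] ∃[ r ] node l i r ⊑ tree T × v ∈ᵛ r

SubtreeAt : 𝒯 n → Fin n → BinTree (Fin n) → Set
SubtreeAt T i s = s ⊑ tree T × rootOf s ≡ just i

rightBranch : BinTree A → List A
rightBranch ε            = []
rightBranch (node _ i r) = i ∷ rightBranch r

dropLast : List A → List A
dropLast []           = []
dropLast (_ ∷ [])     = []
dropLast (x ∷ y ∷ xs) = x ∷ dropLast (y ∷ xs)

InBR⁻ : 𝒯 n → Fin n → Fin n → Set
InBR⁻ T i j = ∃[ s ] SubtreeAt T i s × j ∈ dropLast (rightBranch s)

IsMinOf IsMaxOf : Fin n → BinTree (Fin n) → Set
IsMinOf m s = m ∈ᵛ s × (∀ {v} → v ∈ᵛ s → m ≤ v)
IsMaxOf m s = m ∈ᵛ s × (∀ {v} → v ∈ᵛ s → v ≤ m)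

NonRoot : 𝒯 k → Set
NonRoot {k} P = [ i ∈ Fin k ∣ rootOf (tree P) ≢ just i ]

TreePattern : ℕ → Set
TreePattern k = Σ[ P ∈ 𝒯 k ] (NonRoot P → Bool)

-- The parent of the non-root vertex i of P enters as the unique p having i
-- as its left or right child.
record IsTreeOccurrence (T : 𝒯 n) (pat : TreePattern k) (f : Fin k → Fin n) : Set where
  private
    P = proj₁ pat
    e = proj₂ pat
  field
    injective : Injective _≡_ _≡_ f
    left₁  : ∀ (i : NonRoot P) {p} → LeftChild P p (value i) →
             e i ≡ true → LeftChild T (f p) (f (value i))
    right₁ : ∀ (i : NonRoot P) {p} → RightChild P p (value i) →
             e i ≡ true → RightChild T (f p) (f (value i))
    left₀  : ∀ (i : NonRoot P) {p} → LeftChild P p (value i) →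
             e i ≡ false → InL T (f p) (f (value i))
    right₀ : ∀ (i : NonRoot P) {p} → RightChild P p (value i) →
             e i ≡ false → InR T (f p) (f (value i))

infix 4 _Containsᵀ_ _Avoidsᵀ_

_Containsᵀ_ _Avoidsᵀ_ : 𝒯 n → TreePattern k → Set
T Containsᵀ pat = ∃[ f ] IsTreeOccurrence T pat f
T Avoidsᵀ pat = ¬ (T Containsᵀ pat)

preorder : BinTree A → List A
preorder ε            = []
preorder (node l i r) = i ∷ preorder l ++ preorder r

length-preorder : (t : BinTree A) → length (preorder t) ≡ #nodes t
length-preorder ε = refl
length-preorder (node l i r)
  rewrite length-++ (preorder l) {preorder r}
        | length-preorder l
        | length-preorder r
        = sym (+-suc (#nodes l) (#nodes r))

∈-preorder⁻ : {v : A} (t : BinTree A) → v ∈ preorder t → v ∈ᵛ t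
∈-preorder⁻ (node l i r) (here refl) = root
∈-preorder⁻ (node l i r) (there v∈) with ∈-++⁻ (preorder l) v∈
... | inj₁ v∈l = left (∈-preorder⁻ l v∈l)
... | inj₂ v∈r = right (∈-preorder⁻ r v∈r)

preorder-unique : (t : BinTree (Fin n)) → IsSearchTree t → Unique (preorder t)
preorder-unique ε _ = []
preorder-unique (node l i r) st =
  tabulate i≢ ∷ ++⁺ (preorder-unique l (st ∘ left)) (preorder-unique r (st ∘ right))
    λ (v∈l , v∈r) → <-irrefl refl (<-trans (l<i (∈-preorder⁻ l v∈l)) (i<r (∈-preorder⁻ r v∈r)))
  where
  l<i = proj₁ (st self)
  i<r = proj₂ (st self)
  i≢ : ∀ {v} → v ∈ preorder l ++ preorder r → i ≢ v
  i≢ v∈ i≡v with ∈-++⁻ (preorder l) v∈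
  ... | inj₁ v∈l = <-irrefl (sym i≡v) (l<i (∈-preorder⁻ l v∈l))
  ... | inj₂ v∈r = <-irrefl i≡v (i<r (∈-preorder⁻ r v∈r))

lookup-injective : {xs : List A} → Unique xs → Injective _≡_ _≡_ (lookup xs)
lookup-injective (_ ∷ _)   {zero}  {zero}  _  = refl
lookup-injective {xs = _ ∷ xs} (x≢ ∷ _) {zero} {suc j} eq =
  contradiction eq (All.lookup x≢ (∈-lookup {xs = xs} j))
lookup-injective {xs = _ ∷ xs} (x≢ ∷ _) {suc i} {zero} eq =
  contradiction (sym eq) (All.lookup x≢ (∈-lookup {xs = xs} i))
lookup-injective (_ ∷ u)   {suc i} {suc j} eq = cong suc (lookup-injective u eq)

injective⇒surjective : {f : Fin n → Fin n} → Injective _≡_ _≡_ f →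
                       ∀ v → ∃[ i ] f i ≡ v
injective⇒surjective {suc n} {f} inj v with any? (λ i → f i ≟ v)
... | yes found = found
... | no ¬found = contradiction
  (injective⇒≤ {f = λ i → punchOut (v≢ i)} λ {i} {j} eq → inj (punchOut-injective (v≢ i) (v≢ j) eq))
  1+n≰n
  where
  v≢ : ∀ i → v ≢ f i
  v≢ i v≡fi = ¬found (i , sym v≡fi)

module _ (T : 𝒯 n) where

  length-word : length (preorder (tree T)) ≡ n
  length-word = trans (length-preorder (tree T)) (size T)

  preorderAt : Fin n → Fin n
  preorderAt i = lookup (preorder (tree T)) (cast (sym length-word) i)

  preorderAt-injective : Injective _≡_ _≡_ preorderAt
  preorderAt-injective {i} {j} eq =
    trans (sym (cast-involutive length-word (sym length-word) i))
      (trans (cong (cast length-word) (lookup-injective (preorder-unique (tree T) (isSearchTree T)) eq))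
        (cast-involutive length-word (sym length-word) j))

  preorderAt-surjective : ∀ v → ∃[ i ] preorderAt i ≡ v
  preorderAt-surjective = injective⇒surjective preorderAt-injective

  τ : Permutation′ n
  τ = permutation preorderAt
        (proj₁ ∘ preorderAt-surjective)
        (proj₂ ∘ preorderAt-surjective)
        (λ i → preorderAt-injective (proj₂ (preorderAt-surjective (preorderAt i))))

Cell : ℕ → Set
Cell k = Fin (suc k) × Fin (suc k)

record MeshPattern (k : ℕ) : Set₁ where
  constructor _,_
  field
    perm  : Permutation′ k
    cells : Pred (Cell k) 0ℓ

-- bounds {n = n} ν = (0, ν₁, …, νₖ, n+1).
bounds : (Fin k → Fin n) → Vector ℕ (2 + k)
bounds {k} {n} ν = 0 ∷ᵛ insertAt (suc ∘ toℕ ∘ ν) (fromℕ k) (suc n)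

InGap : (Fin k → Fin n) → Fin (suc k) → Fin n → Set
InGap ν i x = bounds ν (inject₁ i) ℕ.< suc (toℕ x) × suc (toℕ x) ℕ.< bounds ν (suc i)

record MeshOccurrence (π : Permutation′ n) (σ : MeshPattern k) : Set where
  open MeshPattern σ
  field
    ν            : Fin k → Fin n
    ν-increasing : Monotonic₁ _<_ _<_ ν
    sameOrder    : ∀ a b → (perm ⟨$⟩ʳ a < perm ⟨$⟩ʳ b) ⇔ (π ⟨$⟩ʳ ν a < π ⟨$⟩ʳ ν b)
    λ′           : Fin k → Fin n
    λ-increasing : Monotonic₁ _<_ _<_ λ′
    λ-values     : ∀ v → (∃[ j ] λ′ j ≡ v) ⇔ (∃[ a ] π ⟨$⟩ʳ ν a ≡ v)
    cells-empty  : ∀ {i j} → cells (i , j) →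
                   ∀ x → ¬ (InGap ν i x × InGap λ′ j (π ⟨$⟩ʳ x))

infix 4 _Containsᴹ_ _Avoidsᴹ_

_Containsᴹ_ _Avoidsᴹ_ : Permutation′ n → MeshPattern k → Set
π Containsᴹ σ = MeshOccurrence π σ
π Avoidsᴹ σ = ¬ (π Containsᴹ σ)

classical : Permutation′ k → MeshPattern k
classical π = π , ∅

perm231 : Permutation′ 3
perm231 = permutation
  (λ { 0F → 1F ; 1F → 2F ; 2F → 0F })
  (λ { 0F → 2F ; 1F → 0F ; 2F → 1F })
  (λ { 0F → refl ; 1F → refl ; 2F → refl })
  (λ { 0F → refl ; 1F → refl ; 2F → refl })

-- For i : Fin k standing for the label i+1, inject₁ i and suc i are the
-- coordinates (label − 1) and (label) in {0,…,k}.

column : 𝒯 k → Fin k → Fin (suc k)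
column P i = inject₁ (τ P ⟨$⟩ˡ i)

C : (P : 𝒯 k) → Fin k → Pred (Cell k) 0ℓ
C P i (a , b) = a ≡ column P i × ∃[ j ] InBR⁻ P i j × b ≡ suc j

C′ : (pat : TreePattern k) → NonRoot (proj₁ pat) → Pred (Cell k) 0ℓ
C′ (P , e) i (a , b) =
  e i ≡ true × a ≡ column P (value i) ×
  ∃[ s ] SubtreeAt P (value i) s ×
    ((∃[ m ] IsMinOf m s × b ≡ inject₁ m) ⊎ (∃[ m ] IsMaxOf m s × b ≡ suc m))

σ : TreePattern k → MeshPattern k
σ {k} pat@(P , _) = τ P , (⋃ (Fin k) (C P) ∪ ⋃ (NonRoot P) (C′ pat))

RestrictsToBijection : {X Y : Set} → Rel X 0ℓ → Rel Y 0ℓ →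
                       (X → Y) → Pred X 0ℓ → Pred Y 0ℓ → Set
RestrictsToBijection _≈₁_ _≈₂_ f A B =
  Σ[ f∈ ∈ (∀ {x} → A x → B (f x)) ]
    IsBijection (_≈₁_ on proj₁) (_≈₂_ on proj₁) (map {P = A} {Q = B} f f∈)

𝒯-avoiding : (n : ℕ) → TreePattern k → Pred (𝒯 n) 0ℓ
𝒯-avoiding n pat T = T Avoidsᵀ pat

S-avoiding-231-and : (n : ℕ) → MeshPattern k → Pred (Permutation′ n) 0ℓ
S-avoiding-231-and n mesh π = (π Avoidsᴹ classical perm231) × (π Avoidsᴹ mesh)

{-# OPTIONS --safe #-}

-- A 231-avoiding word starting with x splits into x, its letters below x, and its letters above x;
-- recursively it is the preorder word of exactly one search tree.
--
-- A tree occurrence f of (P,e) in T is increasing both for the labels and for the preorder ≺, so it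
-- is an occurrence of τ(P) with value sequence f, and the shaded cells are empty.  Conversely, let f
-- come from a mesh occurrence.  Since w ∈ L(u) iff w < u and u ≺ w, left descendants are preserved
-- automatically.  For u < w and u ≺ w, either w ∈ R(u) or some c has u ∈ L(c) and w ∈ R(c); the cells
-- C_i exclude such a c, so right descendants are preserved as well.  If e(i) = 1 and f(i) were not
-- the required child c of f(p(i)), then c would lie in one of the two cells of C_i′.
module Submission where

open import Defs
open import Data.Bool.Base using (true; false)
open import Data.Empty using (⊥; ⊥-elim; ⊥-elim-irr)
open import Data.Fin.Base using (Fin; zero; suc; toℕ; fromℕ; inject₁; cast; _<_; _≤_)
open import Data.Fin.Induction using (<-wellFounded; <-weakInduction)
open import Data.Fin.Patterns using (0F; 1F; 2F)
open import Data.Fin.Permutation using (_≈_; Permutation′; _⟨$⟩ʳ_; _⟨$⟩ˡ_; inverseˡ; inverseʳ)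
open import Data.Fin.Properties using (<-trans; <-irrefl; <-asym; <-cmp; <⇒≢; _<?_; any?; cast-is-id; toℕ-cast; toℕ-inject₁; toℕ-fromℕ; toℕ<n; toℕ-injective)
open import Data.Irrelevant using ([_])
open import Data.List.Base using (List; []; _∷_; _++_; length; lookup; map; tabulate)
open import Data.List.Membership.Propositional using (_∈_)
open import Data.List.Membership.Propositional.Properties using (∈-++⁺ˡ; ∈-++⁺ʳ; ∈-lookup)
open import Data.List.Properties using (∷-injective; length-++; length-tabulate; map-∘; tabulate-cong; tabulate-lookup)
open import Data.List.Relation.Binary.Sublist.Propositional using (_⊆_; []; _∷_; _∷ʳ_; ⊆-refl; ⊆-trans; from∈; to∈)
open import Data.List.Relation.Binary.Sublist.Propositional.Properties using (++⁺; ++⁺ˡ; ++⁺ʳ; ∷ˡ⁻; All-resp-⊆)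
open import Data.List.Relation.Unary.All using (All; []; _∷_)
import Data.List.Relation.Unary.All as All
import Data.List.Relation.Unary.All.Properties as All
open import Data.List.Relation.Unary.AllPairs using (AllPairs; []; _∷_)
import Data.List.Relation.Unary.AllPairs as AllPairs
import Data.List.Relation.Unary.AllPairs.Properties as AllPairs
open import Data.List.Relation.Unary.Any using (here; there)
open import Data.List.Relation.Unary.Unique.Propositional using (Unique)
import Data.List.Relation.Unary.Unique.Propositional.Properties as Unique
open import Data.Maybe.Base using (just)
open import Data.Nat.Base using (ℕ; zero; suc; z<s; s<s; s≤s; s<s⁻¹)
import Data.Nat.Base as ℕ
import Data.Nat.Properties as ℕ
open import Data.Product.Base using (∃-syntax; _×_; _,_; proj₁; proj₂)
open import Data.Refinement using (_,_; value)
open import Data.Sum.Base using (_⊎_; inj₁; inj₂; [_,_]′)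
open import Data.Tree.Binary using (node)
open import Data.Fin.Relation.Unary.Top using (view; ‵fromℕ; ‵inject₁)
open import Data.Vec.Functional using (Vector; insertAt; tail)
open import Data.Vec.Functional.Properties using (insertAt-lookup)
open import Function.Base using (_∘_)
open import Function.Bundles using (_⇔_; mk⇔; Equivalence)
open import Induction.WellFounded using (Acc; acc)
open import Level using (0ℓ)
open import Relation.Binary.Core using (Rel)
open import Relation.Binary.Definitions using (tri<; tri≈; tri>; Monotonic₁)
open import Relation.Binary.PropositionalEquality using (_≡_; _≢_; refl; sym; trans; cong; cong₂; subst; subst₂)
open import Relation.Nullary using (¬_; Dec; yes; no; contradiction)
open import Relation.Nullary.Decidable using (_×-dec_; map′)
open import Relation.Unary using (Pred; Decidable)

private
  variable
    A : Set
    k n : ℕ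

-- Subtrees of search trees

∈ᵛ-resp-⊑ : ∀ {v : A} {s t} → s ⊑ t → v ∈ᵛ s → v ∈ᵛ t
∈ᵛ-resp-⊑ self      v∈ = v∈
∈ᵛ-resp-⊑ (left p)  v∈ = left (∈ᵛ-resp-⊑ p v∈)
∈ᵛ-resp-⊑ (right p) v∈ = right (∈ᵛ-resp-⊑ p v∈)

⊑-trans : ∀ {s t u : BinTree A} → s ⊑ t → t ⊑ u → s ⊑ u
⊑-trans p self      = p
⊑-trans p (left q)  = left (⊑-trans p q)
⊑-trans p (right q) = right (⊑-trans p q)

∈ᵛ⇒⊑ : ∀ {v : A} {t} → v ∈ᵛ t → ∃[ l ] ∃[ r ] node l v r ⊑ t
∈ᵛ⇒⊑ root = _ , _ , self
∈ᵛ⇒⊑ (left v∈)  = let l , r , p = ∈ᵛ⇒⊑ v∈ in l , r , left p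
∈ᵛ⇒⊑ (right v∈) = let l , r , p = ∈ᵛ⇒⊑ v∈ in l , r , right p

-- Left labels are smaller and right labels larger than the label above them, so a label determines
-- the path to it. This identifies the subtrees hidden in separate existentials such as `InL` and
-- `InR`.
node-unique : ∀ {t : BinTree (Fin n)} {i l r l′ r′} → IsSearchTree t →
              node l i r ⊑ t → node l′ i r′ ⊑ t → node l i r ≡ node l′ i r′
node-unique st self      self      = refl
node-unique st self      (left q)  = contradiction refl (<⇒≢ (proj₁ (st self) (∈ᵛ-resp-⊑ q root)))
node-unique st self      (right q) = contradiction refl (<⇒≢ (proj₂ (st self) (∈ᵛ-resp-⊑ q root)))
node-unique st (left p)  self      = contradiction refl (<⇒≢ (proj₁ (st self) (∈ᵛ-resp-⊑ p root)))
node-unique st (right p) self      = contradiction refl (<⇒≢ (proj₂ (st self) (∈ᵛ-resp-⊑ p root)))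
node-unique st (left p)  (left q)  = node-unique (st ∘ left) p q
node-unique st (right p) (right q) = node-unique (st ∘ right) p q
node-unique st (left p)  (right q) =
  contradiction (proj₂ (st self) (∈ᵛ-resp-⊑ q root)) (<-asym (proj₁ (st self) (∈ᵛ-resp-⊑ p root)))
node-unique st (right p) (left q)  =
  contradiction (proj₁ (st self) (∈ᵛ-resp-⊑ q root)) (<-asym (proj₂ (st self) (∈ᵛ-resp-⊑ p root)))

minimum : ∀ {l i r} {t : BinTree (Fin n)} → IsSearchTree t → node l i r ⊑ t →
          ∃[ m ] IsMinOf m (node l i r)
minimum {l = ε} {i} {r} st p = i , root , least
  where
  least : ∀ {v} → v ∈ᵛ node ε i r → i ≤ v
  least root       = ℕ.≤-refl
  least (right v∈) = ℕ.<⇒≤ (proj₂ (st p) v∈)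
minimum {l = l@(node _ _ _)} {i} {r} st p with minimum st (⊑-trans (left self) p)
... | m , m∈l , m≤ = m , left m∈l , least
  where
  least : ∀ {v} → v ∈ᵛ node l i r → m ≤ v
  least root       = ℕ.<⇒≤ (proj₁ (st p) m∈l)
  least (left v∈)  = m≤ v∈
  least (right v∈) = ℕ.<⇒≤ (<-trans (proj₁ (st p) m∈l) (proj₂ (st p) v∈))

maximum : ∀ {l i r} {t : BinTree (Fin n)} → IsSearchTree t → node l i r ⊑ t →
          ∃[ m ] IsMaxOf m (node l i r)
maximum {l = l} {i} {ε} st p = i , root , greatest
  where
  greatest : ∀ {v} → v ∈ᵛ node l i ε → v ≤ i
  greatest root      = ℕ.≤-refl
  greatest (left v∈) = ℕ.<⇒≤ (proj₁ (st p) v∈)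
maximum {l = l} {i} {r@(node _ _ _)} st p with maximum st (⊑-trans (right self) p)
... | m , m∈r , ≤m = m , right m∈r , greatest
  where
  greatest : ∀ {v} → v ∈ᵛ node l i r → v ≤ m
  greatest root       = ℕ.<⇒≤ (proj₂ (st p) m∈r)
  greatest (left v∈)  = ℕ.<⇒≤ (<-trans (proj₁ (st p) v∈) (proj₂ (st p) m∈r))
  greatest (right v∈) = ≤m v∈

-- Preorder words and positions in them

∈-preorder⁺ : ∀ {v : A} {t} → v ∈ᵛ t → v ∈ preorder t
∈-preorder⁺ root       = here refl
∈-preorder⁺ (left v∈)  = there (∈-++⁺ˡ (∈-preorder⁺ v∈))
∈-preorder⁺ (right v∈) = there (∈-++⁺ʳ _ (∈-preorder⁺ v∈))

preorder-⊑ : ∀ {s t : BinTree A} → s ⊑ t → preorder s ⊆ preorder t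
preorder-⊑ self = ⊆-refl
preorder-⊑ (left {r = r} p)  = _ ∷ʳ ++⁺ʳ (preorder r) (preorder-⊑ p)
preorder-⊑ (right {l = l} p) = _ ∷ʳ ++⁺ˡ (preorder l) (preorder-⊑ p)

-- `Unique` rules out any other occurrence of u or v, so the embedding fixes both indices.
⊆⇒lookup-< : ∀ {xs : List A} {u v} → Unique xs → (u ∷ v ∷ []) ⊆ xs →
             ∀ {i j} → lookup xs i ≡ u → lookup xs j ≡ v → i < j
⊆⇒lookup-< (x≢ ∷ _) (_ ∷ʳ p)   {zero}  {_}     refl _ = contradiction refl (All.lookup x≢ (to∈ (⊆-trans (refl ∷ (_ ∷ʳ [])) p)))
⊆⇒lookup-< (x≢ ∷ _) (_ ∷ʳ p)   {suc i} {zero}  _ refl = contradiction refl (All.lookup x≢ (to∈ (∷ˡ⁻ p)))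
⊆⇒lookup-< (_ ∷ uq) (_ ∷ʳ p)   {suc i} {suc j} eq eq′ = s<s (⊆⇒lookup-< uq p eq eq′)
⊆⇒lookup-< (x≢ ∷ _) (refl ∷ p) {_}     {zero}  _ refl = contradiction refl (All.lookup x≢ (to∈ p))
⊆⇒lookup-< (x≢ ∷ _) (refl ∷ p) {zero}  {suc j} _ _    = z<s
⊆⇒lookup-< {xs = _ ∷ xs} (x≢ ∷ _) (refl ∷ p) {suc i} {suc j} eq _ =
  contradiction (sym eq) (All.lookup x≢ (∈-lookup {xs = xs} i))

least : {Q : Pred (Fin n) 0ℓ} → Decidable Q → ∀ {a} → Q a → ∃[ b ] Q b × (∀ {c} → c < b → ¬ Q c)
least {Q = Q} Q? {a} qa = go (<-wellFounded a) qa
  where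
  go : ∀ {a} → Acc _<_ a → Q a → ∃[ b ] Q b × (∀ {c} → c < b → ¬ Q c)
  go {a} (acc rs) qa with any? (λ c → c <? a ×-dec Q? c)
  ... | yes (c , c<a , qc) = go (rs c<a) qc
  ... | no ¬smaller        = a , qa , λ {c} c<a qc → ¬smaller (c , c<a , qc)

-- The value order < and the preorder ≺ on the vertices of a search tree

module Order {n} (T : 𝒯 n) where

  infix 4 _≺_

  -- A record rather than a synonym, so that unification recovers u and v from the type; the
  -- inequality mentions them only under the inverse of `τ T`.
  record _≺_ (u v : Fin n) : Set where
    constructor mk≺
    field position-< : τ T ⟨$⟩ˡ u < τ T ⟨$⟩ˡ v
  open _≺_ public

  private
    st : IsSearchTree (tree T)
    st = isSearchTree T

  ≺-trans : ∀ {u v w} → u ≺ v → v ≺ w → u ≺ w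
  ≺-trans (mk≺ p) (mk≺ q) = mk≺ (<-trans p q)

  ≺-irrefl : ∀ {u} → ¬ u ≺ u
  ≺-irrefl (mk≺ p) = <-irrefl refl p

  ≺-asym : ∀ {u v} → u ≺ v → ¬ v ≺ u
  ≺-asym p q = ≺-irrefl (≺-trans p q)

  ≺-cmp : ∀ u v → u ≺ v ⊎ u ≡ v ⊎ v ≺ u
  ≺-cmp u v with <-cmp (τ T ⟨$⟩ˡ u) (τ T ⟨$⟩ˡ v)
  ... | tri< p _ _  = inj₁ (mk≺ p)
  ... | tri≈ _ eq _ = inj₂ (inj₁ (trans (sym (inverseʳ (τ T))) (trans (cong (τ T ⟨$⟩ʳ_) eq) (inverseʳ (τ T)))))
  ... | tri> _ _ p  = inj₂ (inj₂ (mk≺ p))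

  _≺?_ : ∀ u v → Dec (u ≺ v)
  u ≺? v = map′ mk≺ position-< (τ T ⟨$⟩ˡ u <? τ T ⟨$⟩ˡ v)

  -- Since `≺` is total, `¬ w ≺ v` serves as the weak order: v is w or precedes it.
  ≺-⊀-trans : ∀ {u v w} → u ≺ v → ¬ w ≺ v → u ≺ w
  ≺-⊀-trans {v = v} {w} p q with ≺-cmp v w
  ... | inj₁ v≺w        = ≺-trans p v≺w
  ... | inj₂ (inj₁ refl) = p
  ... | inj₂ (inj₂ w≺v) = contradiction w≺v q

  ⊀-≺-trans : ∀ {u v w} → ¬ v ≺ u → v ≺ w → u ≺ w
  ⊀-≺-trans {u} {v} q p with ≺-cmp u v
  ... | inj₁ u≺v        = ≺-trans u≺v p
  ... | inj₂ (inj₁ refl) = p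
  ... | inj₂ (inj₂ v≺u) = contradiction v≺u q

  ≺-least : {Q : Pred (Fin n) 0ℓ} → Decidable Q → ∀ {u} → Q u → ∃[ v ] Q v × (∀ {w} → w ≺ v → ¬ Q w)
  ≺-least {Q} Q? {u} qu with least (Q? ∘ (τ T ⟨$⟩ʳ_)) (subst Q (sym (inverseʳ (τ T) {u})) qu)
  ... | a , qa , min = τ T ⟨$⟩ʳ a , qa ,
    λ (mk≺ w<a) qw → min (subst (_ <_) (inverseˡ (τ T)) w<a) (subst Q (sym (inverseʳ (τ T))) qw)

  ⊆⇒≺ : ∀ {u v} → (u ∷ v ∷ []) ⊆ preorder (tree T) → u ≺ v
  ⊆⇒≺ {u} {v} p = mk≺ (subst₂ ℕ._<_ (toℕ-cast _ (τ T ⟨$⟩ˡ u)) (toℕ-cast _ (τ T ⟨$⟩ˡ v))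
    (⊆⇒lookup-< (preorder-unique (tree T) st) p (inverseʳ (τ T)) (inverseʳ (τ T))))

  vertex : ∀ v → v ∈ᵛ tree T
  vertex v = ∈-preorder⁻ (tree T) (subst (_∈ preorder (tree T)) (inverseʳ (τ T)) (∈-lookup _))

  -- Ancestry read off from the two orders

  L⇒≺ : ∀ {u v} → InL T u v → u ≺ v
  L⇒≺ (l , r , p , v∈l) = ⊆⇒≺ (⊆-trans (refl ∷ from∈ (∈-++⁺ˡ (∈-preorder⁺ v∈l))) (preorder-⊑ p))

  R⇒≺ : ∀ {u v} → InR T u v → u ≺ v
  R⇒≺ (l , r , p , v∈r) = ⊆⇒≺ (⊆-trans (refl ∷ from∈ (∈-++⁺ʳ (preorder l) (∈-preorder⁺ v∈r))) (preorder-⊑ p))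

  L⇒< : ∀ {u v} → InL T u v → v < u
  L⇒< (l , r , p , v∈l) = proj₁ (st p) v∈l

  R⇒< : ∀ {u v} → InR T u v → u < v
  R⇒< (l , r , p , v∈r) = proj₂ (st p) v∈r

  -- The word of the subtree at c is c, then the word of L(c), then that of R(c).
  LR⇒≺ : ∀ {c u v} → InL T c u → InR T c v → u ≺ v
  LR⇒≺ (l , r , p , u∈l) (l′ , r′ , q , v∈r) with node-unique st p q
  ... | refl = ⊆⇒≺ (⊆-trans (_ ∷ʳ ++⁺ (from∈ (∈-preorder⁺ u∈l)) (from∈ (∈-preorder⁺ v∈r))) (preorder-⊑ p))

  -- Here c is the lowest common ancestor of u and w, and is neither of them.
  Split : Rel (Fin n) _
  Split u w = ∃[ c ] InL T c u × InR T c w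

  -- Follow the path from the root as long as u and w lie in the same subtree; the vertex at which
  -- this stops is u, is w, or separates them.
  <⇒relation : ∀ {u w} → u < w → InR T u w ⊎ InL T w u ⊎ Split u w
  <⇒relation {u} {w} u<w = go self (vertex u) (vertex w)
    where
    go : ∀ {t} → t ⊑ tree T → u ∈ᵛ t → w ∈ᵛ t → InR T u w ⊎ InL T w u ⊎ Split u w
    go p root       root       = contradiction refl (<⇒≢ u<w)
    go p root       (left w∈)  = contradiction (proj₁ (st p) w∈) (<-asym u<w)
    go p root       (right w∈) = inj₁ (_ , _ , p , w∈)
    go p (left u∈)  root       = inj₂ (inj₁ (_ , _ , p , u∈))
    go p (left u∈)  (left w∈)  = go (⊑-trans (left self) p) u∈ w∈
    go p (left u∈)  (right w∈) = inj₂ (inj₂ (_ , (_ , _ , p , u∈) , (_ , _ , p , w∈)))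
    go p (right u∈) root       = contradiction (proj₂ (st p) u∈) (<-asym u<w)
    go p (right u∈) (left w∈)  = contradiction (<-trans (proj₁ (st p) w∈) (proj₂ (st p) u∈)) (<-asym u<w)
    go p (right u∈) (right w∈) = go (⊑-trans (right self) p) u∈ w∈

  -- In the two other relations allowed by w < u, w precedes u in preorder.
  >∧≺⇒L : ∀ {u w} → w < u → u ≺ w → InL T u w
  >∧≺⇒L w<u u≺w with <⇒relation w<u
  ... | inj₁ wRu                     = contradiction (R⇒≺ wRu) (≺-asym u≺w)
  ... | inj₂ (inj₁ uLw)              = uLw
  ... | inj₂ (inj₂ (_ , cLw , cRu)) = contradiction (LR⇒≺ cLw cRu) (≺-asym u≺w)

  <∧≺⇒R⊎Split : ∀ {u w} → u < w → u ≺ w → InR T u w ⊎ Split u w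
  <∧≺⇒R⊎Split u<w u≺w with <⇒relation u<w
  ... | inj₁ uRw        = inj₁ uRw
  ... | inj₂ (inj₁ wLu) = contradiction (L⇒≺ wLu) (≺-asym u≺w)
  ... | inj₂ (inj₂ s)   = inj₂ s

  Below : Rel (Fin n) _
  Below u w = w ≡ u ⊎ InL T u w ⊎ InR T u w

  below⁺ : ∀ {l u r w} → node l u r ⊑ tree T → w ∈ᵛ node l u r → Below u w
  below⁺ p root       = inj₁ refl
  below⁺ p (left w∈)  = inj₂ (inj₁ (_ , _ , p , w∈))
  below⁺ p (right w∈) = inj₂ (inj₂ (_ , _ , p , w∈))

  below⁻ : ∀ {l u r w} → node l u r ⊑ tree T → Below u w → w ∈ᵛ node l u r
  below⁻ p (inj₁ refl) = root
  below⁻ p (inj₂ (inj₁ (_ , _ , q , w∈))) with node-unique st p q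
  ... | refl = left w∈
  below⁻ p (inj₂ (inj₂ (_ , _ , q , w∈))) with node-unique st p q
  ... | refl = right w∈

  below⇒⊀ : ∀ {u w} → Below u w → ¬ w ≺ u
  below⇒⊀ (inj₁ refl)       = ≺-irrefl
  below⇒⊀ (inj₂ (inj₁ uLw)) = ≺-asym (L⇒≺ uLw)
  below⇒⊀ (inj₂ (inj₂ uRw)) = ≺-asym (R⇒≺ uRw)

  L-below : ∀ {c u w} → InL T c u → Below u w → InL T c w
  L-below (l , r , p , u∈l) b with ∈ᵛ⇒⊑ u∈l
  ... | _ , _ , q = l , r , p , ∈ᵛ-resp-⊑ q (below⁻ (⊑-trans q (⊑-trans (left self) p)) b)

  R-below : ∀ {c u w} → InR T c u → Below u w → InR T c w
  R-below (l , r , p , u∈r) b with ∈ᵛ⇒⊑ u∈r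
  ... | _ , _ , q = l , r , p , ∈ᵛ-resp-⊑ q (below⁻ (⊑-trans q (⊑-trans (right self) p)) b)

  ≺⇒Below⊎Split : ∀ {u w} → u ≺ w → Below u w ⊎ Split u w
  ≺⇒Below⊎Split {u} {w} u≺w with <-cmp u w
  ... | tri≈ _ refl _ = inj₁ (inj₁ refl)
  ... | tri> _ _ w<u  = inj₁ (inj₂ (inj₁ (>∧≺⇒L w<u u≺w)))
  ... | tri< u<w _ _ with <∧≺⇒R⊎Split u<w u≺w
  ...   | inj₁ uRw = inj₁ (inj₂ (inj₂ uRw))
  ...   | inj₂ s   = inj₂ s

  -- If u ≺ c, the two orders already force c ∈ L(u). Otherwise u lies in R(d), where d is c or an
  -- ancestor having c on its left; then w ∈ L(d), so w would precede u.
  L-convex : ∀ {u c w} → InL T u w → w < c → c < u → InL T u c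
  L-convex {u} {c} uLw w<c c<u with ≺-cmp u c
  ... | inj₁ u≺c         = >∧≺⇒L c<u u≺c
  ... | inj₂ (inj₁ refl) = contradiction refl (<⇒≢ c<u)
  ... | inj₂ (inj₂ c≺u) with <∧≺⇒R⊎Split c<u c≺u
  ...   | inj₁ cRu =
    contradiction (LR⇒≺ (>∧≺⇒L w<c (≺-trans c≺u (L⇒≺ uLw))) cRu) (≺-asym (L⇒≺ uLw))
  ...   | inj₂ (_ , dLc , dRu) =
    contradiction (LR⇒≺ (>∧≺⇒L (<-trans w<c (L⇒< dLc)) (≺-trans (R⇒≺ dRu) (L⇒≺ uLw))) dRu) (≺-asym (L⇒≺ uLw))

  -- Otherwise c, or a vertex separating u from c, has u in its left subtree. All of T(u), and with
  -- it w, is then smaller than that vertex, contrary to c < w.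
  R-convex : ∀ {u c w} → InR T u w → u < c → c < w → InR T u c
  R-convex {u} {c} uRw u<c c<w with ≺-cmp u c
  ... | inj₂ (inj₁ refl) = contradiction refl (<⇒≢ u<c)
  ... | inj₂ (inj₂ c≺u)  =
    contradiction c<w (<-asym (L⇒< (L-below (>∧≺⇒L u<c c≺u) (inj₂ (inj₂ uRw)))))
  ... | inj₁ u≺c with <∧≺⇒R⊎Split u<c u≺c
  ...   | inj₁ uRc = uRc
  ...   | inj₂ (_ , dLu , dRc) =
    contradiction (<-trans (R⇒< dRc) c<w) (<-asym (L⇒< (L-below dLu (inj₂ (inj₂ uRw)))))

  L-convex-≤ : ∀ {u c w} → InL T u w → w ≤ c → c < u → InL T u c
  L-convex-≤ {c = c} {w} uLw w≤c c<u with <-cmp w c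
  ... | tri< w<c _ _  = L-convex uLw w<c c<u
  ... | tri≈ _ refl _ = uLw
  ... | tri> _ _ c<w  = contradiction w≤c (ℕ.<⇒≱ c<w)

  R-convex-≤ : ∀ {u c w} → InR T u w → u < c → c ≤ w → InR T u c
  R-convex-≤ {c = c} {w} uRw u<c c≤w with <-cmp c w
  ... | tri< c<w _ _  = R-convex uRw u<c c<w
  ... | tri≈ _ refl _ = uRw
  ... | tri> _ _ w<c  = contradiction c≤w (ℕ.<⇒≱ w<c)

  -- The vertices that follow u outside L(u) lie in R(u) or are separated from u by some d; either
  -- way all of L(u) precedes them.
  L-contiguous : ∀ {u c w} → InL T u w → u ≺ c → c ≺ w → InL T u c
  L-contiguous uLw u≺c c≺w with ≺⇒Below⊎Split u≺c
  ... | inj₁ (inj₁ refl)       = contradiction u≺c ≺-irrefl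
  ... | inj₁ (inj₂ (inj₁ uLc)) = uLc
  ... | inj₁ (inj₂ (inj₂ uRc)) = contradiction (LR⇒≺ uLw uRc) (≺-asym c≺w)
  ... | inj₂ (_ , dLu , dRc)   =
    contradiction (LR⇒≺ (L-below dLu (inj₂ (inj₁ uLw))) dRc) (≺-asym c≺w)

  -- Children, right branches and extreme labels of subtrees

  leftChild⇒L : ∀ {p i} → LeftChild T p i → InL T p i
  leftChild⇒L (_ , _ , _ , q) = _ , _ , q , root

  rightChild⇒R : ∀ {p i} → RightChild T p i → InR T p i
  rightChild⇒R (_ , _ , _ , q) = _ , _ , q , root

  leftChild-below : ∀ {p i v} → LeftChild T p i → InL T p v → Below i v
  leftChild-below (_ , _ , _ , q) (_ , _ , q′ , v∈) with node-unique st q q′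
  ... | refl = below⁺ (⊑-trans (left self) q) v∈

  rightChild-below : ∀ {p i v} → RightChild T p i → InR T p v → Below i v
  rightChild-below (_ , _ , _ , q) (_ , _ , q′ , v∈) with node-unique st q q′
  ... | refl = below⁺ (⊑-trans (right self) q) v∈

  -- L(p) directly follows p in the preorder, and its root i comes first there.
  leftChild-adjacent : ∀ {p i v} → LeftChild T p i → p ≺ v → ¬ v ≺ i
  leftChild-adjacent lc p≺v v≺i =
    below⇒⊀ (leftChild-below lc (L-contiguous (leftChild⇒L lc) p≺v v≺i)) v≺i

  -- Between p and its right child the preorder lists only L(p), whose labels are below p; hence the
  -- hypothesis `p < v`.
  rightChild-adjacent : ∀ {p i v} → RightChild T p i → p ≺ v → p < v → ¬ v ≺ i
  rightChild-adjacent rc p≺v p<v v≺i with <∧≺⇒R⊎Split p<v p≺v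
  ... | inj₁ pRv             = below⇒⊀ (rightChild-below rc pRv) v≺i
  ... | inj₂ (_ , dLp , dRv) = ≺-asym v≺i (LR⇒≺ (L-below dLp (inj₂ (inj₂ (rightChild⇒R rc)))) dRv)

  -- Every vertex lies below the root, so none comes before it.
  ≺⇒nonRoot : ∀ {p i} → p ≺ i → rootOf (tree T) ≢ just i
  ≺⇒nonRoot {p} p≺i eq = go (tree T) self (vertex p) eq
    where
    go : ∀ t → t ⊑ tree T → p ∈ᵛ t → rootOf t ≢ just _
    go (node _ _ _) q p∈ refl = below⇒⊀ (below⁺ q p∈) p≺i

  parent : (i : NonRoot T) → ∃[ p ] (LeftChild T p (value i) ⊎ RightChild T p (value i))
  parent (i , [ nr ]) = [ (λ isRoot → ⊥-elim-irr (nr isRoot)) , (λ par → par) ]′ (go self (vertex i))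
    where
    go : ∀ {t} → t ⊑ tree T → i ∈ᵛ t → rootOf t ≡ just i ⊎ ∃[ p ] (LeftChild T p i ⊎ RightChild T p i)
    go p root = inj₁ refl
    go {node (node _ _ _) _ _} p (left i∈) with go (⊑-trans (left self) p) i∈
    ... | inj₁ refl = inj₂ (_ , inj₁ (_ , _ , _ , p))
    ... | inj₂ par  = inj₂ par
    go {node _ _ (node _ _ _)} p (right i∈) with go (⊑-trans (right self) p) i∈
    ... | inj₁ refl = inj₂ (_ , inj₂ (_ , _ , _ , p))
    ... | inj₂ par  = inj₂ par

  subtree-below : ∀ {i s v} → SubtreeAt T i s → v ∈ᵛ s → Below i v
  subtree-below {s = node _ _ _} (p , refl) v∈ = below⁺ p v∈

  -- An entry that `dropLast` keeps is followed by another on the branch, namely its right child.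
  BR⁻⇒below : ∀ {i j} → InBR⁻ T i j → Below i j × ∃[ c ] RightChild T j c
  BR⁻⇒below {i} {j} (s , at@(p , _) , j∈) = let j∈s , rc = go s p j∈ in subtree-below at j∈s , rc
    where
    go : ∀ s → s ⊑ tree T → j ∈ dropLast (rightBranch s) → j ∈ᵛ s × ∃[ c ] RightChild T j c
    go (node _ _ (node _ _ _)) q (here refl) = root , _ , _ , _ , _ , q
    go (node _ _ r@(node _ _ _)) q (there j∈) =
      let j∈r , rc = go r (⊑-trans (right self) q) j∈ in right j∈r , rc

  -- The path from the root of s to j either always goes right or turns left at some x.
  rightBranch⊎L : ∀ {s j} → s ⊑ tree T → j ∈ᵛ s → j ∈ rightBranch s ⊎ ∃[ x ] x ∈ᵛ s × InL T x j
  rightBranch⊎L q root      = inj₁ (here refl)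
  rightBranch⊎L q (left j∈) = inj₂ (_ , root , _ , _ , q , j∈)
  rightBranch⊎L q (right j∈) with rightBranch⊎L (⊑-trans (right self) q) j∈
  ... | inj₁ j∈b            = inj₁ (there j∈b)
  ... | inj₂ (x , x∈ , xLj) = inj₂ (x , right x∈ , xLj)

  rightChild⇒dropLast : ∀ {j c} s → s ⊑ tree T → RightChild T j c →
                        j ∈ rightBranch s → j ∈ dropLast (rightBranch s)
  rightChild⇒dropLast (node _ _ _) q (_ , _ , _ , q′) (here refl) with node-unique st q q′
  ... | refl = here refl
  rightChild⇒dropLast (node _ _ r@(node _ _ _)) q rc (there j∈) =
    there (rightChild⇒dropLast r (⊑-trans (right self) q) rc j∈)

  below⇒BR⁻⊎L : ∀ {i j c} → Below i j → RightChild T j c →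
                InBR⁻ T i j ⊎ ∃[ x ] Below i x × InL T x j
  below⇒BR⁻⊎L {i} b rc with ∈ᵛ⇒⊑ (vertex i)
  ... | _ , _ , p with rightBranch⊎L p (below⁻ p b)
  ...   | inj₁ j∈             = inj₁ (_ , (p , refl) , rightChild⇒dropLast _ p rc j∈)
  ...   | inj₂ (x , x∈ , xLj) = inj₂ (x , below⁺ p x∈ , xLj)

  -- The subtree form is what the cells of `C′` ask for; the `Below` form is what the order
  -- arguments use.
  below-min : ∀ i → ∃[ s ] ∃[ m ] SubtreeAt T i s × IsMinOf m s × Below i m × (∀ {v} → Below i v → m ≤ v)
  below-min i with ∈ᵛ⇒⊑ (vertex i)
  ... | _ , _ , p with minimum st p
  ...   | m , m∈ , m≤ = _ , m , (p , refl) , (m∈ , m≤) , below⁺ p m∈ , λ b → m≤ (below⁻ p b)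

  below-max : ∀ i → ∃[ s ] ∃[ m ] SubtreeAt T i s × IsMaxOf m s × Below i m × (∀ {v} → Below i v → v ≤ m)
  below-max i with ∈ᵛ⇒⊑ (vertex i)
  ... | _ , _ , p with maximum st p
  ...   | m , m∈ , ≤m = _ , m , (p , refl) , (m∈ , ≤m) , below⁺ p m∈ , λ b → ≤m (below⁻ p b)
-- Gaps and increasing sequences

mono⇒mono-≤ : {f : Fin k → Fin n} → Monotonic₁ _<_ _<_ f → ∀ {a b} → a ≤ b → f a ≤ f b
mono⇒mono-≤ mono {a} {b} a≤b with <-cmp a b
... | tri< a<b _ _  = ℕ.<⇒≤ (mono a<b)
... | tri≈ _ refl _ = ℕ.≤-refl
... | tri> _ _ b<a  = contradiction a≤b (ℕ.<⇒≱ b<a)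

mono⇒reflects-< : {f : Fin k → Fin n} → Monotonic₁ _<_ _<_ f → ∀ {a b} → f a < f b → a < b
mono⇒reflects-< mono fa<fb = ℕ.≰⇒> (λ b≤a → ℕ.<⇒≱ fa<fb (mono⇒mono-≤ mono b≤a))

increasing⇒≤ : {φ : Fin k → Fin k} → Monotonic₁ _<_ _<_ φ → ∀ j → j ≤ φ j
increasing⇒≤ {suc k} {φ} mono = <-weakInduction (λ j → j ≤ φ j) ℕ.z≤n
  λ i i≤ → ℕ.≤-<-trans (subst (ℕ._≤ toℕ (φ (inject₁ i))) (toℕ-inject₁ i) i≤) (mono (s≤s (ℕ.≤-reflexive (toℕ-inject₁ i))))

-- Writing g as h composed with an index map makes that map increasing, hence at least the identity.
-- Used in both directions, this shows that two increasing sequences with equal images coincide.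
increasing-image⇒≤ : {g h : Fin k → Fin n} → Monotonic₁ _<_ _<_ g → Monotonic₁ _<_ _<_ h →
                     (∀ j → ∃[ i ] h i ≡ g j) → ∀ j → h j ≤ g j
increasing-image⇒≤ {h = h} g↑ h↑ image j =
  subst (h j ≤_) (proj₂ (image j)) (mono⇒mono-≤ h↑ (increasing⇒≤ index↑ j))
  where
  index↑ : Monotonic₁ _<_ _<_ (proj₁ ∘ image)
  index↑ {a} {b} a<b = mono⇒reflects-< h↑
    (subst₂ _<_ (sym (proj₂ (image a))) (sym (proj₂ (image b))) (g↑ a<b))

insertAt-inject₁ : ∀ (xs : Vector A k) v (a : Fin k) → insertAt xs (fromℕ k) v (inject₁ a) ≡ xs a
insertAt-inject₁ {k = suc k} xs v zero    = refl
insertAt-inject₁ {k = suc k} xs v (suc a) = insertAt-inject₁ (tail xs) v a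

module _ (ν : Fin k → Fin n) {x : Fin n} where

  -- Counting entries from zero, gap i has the entries a < i before it and those with i ≤ a after
  -- it. The sentinels 0 and n + 1 of `bounds` impose nothing.
  inGap⁺ : ∀ {i} → (∀ a → toℕ a ℕ.< toℕ i → ν a < x) → (∀ a → toℕ i ℕ.≤ toℕ a → x < ν a) → InGap ν i x
  inGap⁺ {i} ν< <ν = lower i ν< , upper i <ν
    where
    lower : ∀ i → (∀ a → toℕ a ℕ.< toℕ i → ν a < x) → bounds ν (inject₁ i) ℕ.< suc (toℕ x)
    lower zero    _  = z<s
    lower (suc i) ν< rewrite insertAt-inject₁ (suc ∘ toℕ ∘ ν) (suc n) i = s<s (ν< i (ℕ.n<1+n _))
    upper : ∀ i → (∀ a → toℕ i ℕ.≤ toℕ a → x < ν a) → suc (toℕ x) ℕ.< bounds ν (suc i)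
    upper i <ν with view i
    ... | ‵fromℕ     rewrite insertAt-lookup (suc ∘ toℕ ∘ ν) (fromℕ k) (suc n) = s<s (toℕ<n x)
    ... | ‵inject₁ a rewrite insertAt-inject₁ (suc ∘ toℕ ∘ ν) (suc n) a =
      s<s (<ν a (ℕ.≤-reflexive (toℕ-inject₁ a)))

  inGap⁻ : Monotonic₁ _<_ _<_ ν → ∀ {i} → InGap ν i x →
           (∀ {a} → toℕ a ℕ.< toℕ i → ν a < x) × (∀ {a} → toℕ i ℕ.≤ toℕ a → x < ν a)
  inGap⁻ ν↑ {i} (lo , hi) = lower i lo , upper i hi
    where
    lower : ∀ i → bounds ν (inject₁ i) ℕ.< suc (toℕ x) → ∀ {a} → toℕ a ℕ.< toℕ i → ν a < x
    lower (suc i) lo a<i rewrite insertAt-inject₁ (suc ∘ toℕ ∘ ν) (suc n) i =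
      ℕ.≤-<-trans (mono⇒mono-≤ ν↑ (ℕ.s≤s⁻¹ a<i)) (s<s⁻¹ lo)
    upper : ∀ i → suc (toℕ x) ℕ.< bounds ν (suc i) → ∀ {a} → toℕ i ℕ.≤ toℕ a → x < ν a
    upper i hi {a} i≤a with view i
    ... | ‵fromℕ     = contradiction (toℕ<n a) (ℕ.≤⇒≯ (subst (ℕ._≤ toℕ a) (toℕ-fromℕ k) i≤a))
    ... | ‵inject₁ b rewrite insertAt-inject₁ (suc ∘ toℕ ∘ ν) (suc n) b =
      ℕ.<-≤-trans (s<s⁻¹ hi) (mono⇒mono-≤ ν↑ (subst (ℕ._≤ toℕ a) (toℕ-inject₁ b) i≤a))

  inGap-inject₁⁺ : ∀ {i} → (∀ a → a < i → ν a < x) → (∀ a → i ≤ a → x < ν a) → InGap ν (inject₁ i) x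
  inGap-inject₁⁺ {i} ν< <ν = inGap⁺
    (λ a a<i → ν< a (subst (toℕ a ℕ.<_) (toℕ-inject₁ i) a<i))
    (λ a i≤a → <ν a (subst (ℕ._≤ toℕ a) (toℕ-inject₁ i) i≤a))

  inGap-inject₁⁻ : Monotonic₁ _<_ _<_ ν → ∀ {i} → InGap ν (inject₁ i) x →
                   (∀ {a} → a < i → ν a < x) × (∀ {a} → i ≤ a → x < ν a)
  inGap-inject₁⁻ ν↑ {i} gap with inGap⁻ ν↑ gap
  ... | ν< , <ν = (λ {a} a<i → ν< (subst (toℕ a ℕ.<_) (sym (toℕ-inject₁ i)) a<i))
                , (λ {a} i≤a → <ν (subst (ℕ._≤ toℕ a) (sym (toℕ-inject₁ i)) i≤a))

-- Occurrences of σ(P,e) in τ(T) as maps of labels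

module Occurrences {k n} (pat : TreePattern k) (T : 𝒯 n) where

  private
    P : 𝒯 k
    P = proj₁ pat
    module P = Order P
    module T = Order T

  -- The gap `column P i` sits just before the position of f i; here positions are replaced by
  -- comparisons in `≺`.
  InColumn : (Fin k → Fin n) → Fin k → Fin n → Set
  InColumn f i d = (∀ b → b P.≺ i → f b T.≺ d) × (∀ b → ¬ b P.≺ i → d T.≺ f b)

  -- A mesh occurrence as one map of labels: f is the sorted value sequence, which together with the
  -- preorder of P determines the positions.
  record IsLabelOccurrence (f : Fin k → Fin n) : Set where
    field
      mono-<      : ∀ {u w} → u < w → f u < f w
      mono-≺      : ∀ {u w} → u P.≺ w → f u T.≺ f w
      C-empty     : ∀ {i j} → InBR⁻ P i j → ∀ d → InColumn f i d → ¬ InGap f (suc j) d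
      min-empty   : ∀ i {s m} → proj₂ pat i ≡ true → SubtreeAt P (value i) s → IsMinOf m s →
                    ∀ d → InColumn f (value i) d → ¬ InGap f (inject₁ m) d
      max-empty   : ∀ i {s m} → proj₂ pat i ≡ true → SubtreeAt P (value i) s → IsMaxOf m s →
                    ∀ d → InColumn f (value i) d → ¬ InGap f (suc m) d

  mesh⇒label : MeshOccurrence (τ T) (σ pat) → ∃[ f ] IsLabelOccurrence f
  mesh⇒label occ = λ′ , record
    { mono-<      = λ-increasing
    ; mono-≺      = λ (P.mk≺ u<w) → T.mk≺ (subst₂ _<_ (sym (position _)) (sym (position _)) (ν-increasing u<w))
    ; C-empty     = λ {i} br → empty (inj₁ (i , refl , _ , br , refl))
    ; min-empty   = λ i e≡ at min → empty (inj₂ (i , e≡ , refl , _ , at , inj₁ (_ , min , refl)))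
    ; max-empty   = λ i e≡ at max → empty (inj₂ (i , e≡ , refl , _ , at , inj₂ (_ , max , refl)))
    }
    where
    open MeshOccurrence occ
    value-at : Fin k → Fin n
    value-at u = τ T ⟨$⟩ʳ ν (τ P ⟨$⟩ˡ u)
    value-at-increasing : Monotonic₁ _<_ _<_ value-at
    value-at-increasing u<w = Equivalence.to (sameOrder _ _)
      (subst₂ _<_ (sym (inverseʳ (τ P))) (sym (inverseʳ (τ P))) u<w)
    -- Both sequences are increasing and have the same values, so the value of rank u is the one
    -- found at the position assigned to u.
    λ≡value-at : ∀ u → λ′ u ≡ value-at u
    λ≡value-at u = toℕ-injective (ℕ.≤-antisym
      (increasing-image⇒≤ value-at-increasing λ-increasing
        (λ w → Equivalence.from (λ-values _) (τ P ⟨$⟩ˡ w , refl)) u)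
      (increasing-image⇒≤ λ-increasing value-at-increasing
        (λ w → let a , eq = Equivalence.to (λ-values _) (w , refl)
               in τ P ⟨$⟩ʳ a , trans (cong (λ b → τ T ⟨$⟩ʳ ν b) (inverseˡ (τ P))) eq) u))
    position : ∀ u → τ T ⟨$⟩ˡ λ′ u ≡ ν (τ P ⟨$⟩ˡ u)
    position u = trans (cong (τ T ⟨$⟩ˡ_) (λ≡value-at u)) (inverseˡ (τ T))
    position′ : ∀ a → τ T ⟨$⟩ˡ λ′ (τ P ⟨$⟩ʳ a) ≡ ν a
    position′ a = trans (position _) (cong ν (inverseˡ (τ P)))
    empty : ∀ {i j} → MeshPattern.cells (σ pat) (column P i , j) →
            ∀ d → InColumn λ′ i d → ¬ InGap λ′ j d
    empty {i} {j} c d (before , after) gap = cells-empty c (τ T ⟨$⟩ˡ d)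
      ( inGap-inject₁⁺ ν
          (λ a a<i → subst₂ _<_ (position′ a) refl
            (T.position-< (before (τ P ⟨$⟩ʳ a) (P.mk≺ (subst (_< τ P ⟨$⟩ˡ i) (sym (inverseˡ (τ P))) a<i)))))
          (λ a i≤a → subst₂ _<_ refl (position′ a)
            (T.position-< (after (τ P ⟨$⟩ʳ a)
              λ (P.mk≺ lt) → ℕ.<⇒≱ (subst (_< τ P ⟨$⟩ˡ i) (inverseˡ (τ P)) lt) i≤a)))
      , subst (InGap λ′ j) (sym (inverseʳ (τ T))) gap )

  label⇒mesh : ∀ {f} → IsLabelOccurrence f → MeshOccurrence (τ T) (σ pat)
  label⇒mesh {f} occ = record
    { ν            = ν
    ; ν-increasing = ν-increasing
    ; sameOrder    = λ a b → mk⇔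
        (λ lt → subst₂ _<_ (sym (inverseʳ (τ T))) (sym (inverseʳ (τ T))) (mono-< lt))
        (λ lt → mono⇒reflects-< mono-< (subst₂ _<_ (inverseʳ (τ T)) (inverseʳ (τ T)) lt))
    ; λ′           = f
    ; λ-increasing = mono-<
    ; λ-values     = λ v → mk⇔
        (λ (j , eq) → τ P ⟨$⟩ˡ j , trans (inverseʳ (τ T)) (trans (cong f (inverseʳ (τ P))) eq))
        (λ (a , eq) → τ P ⟨$⟩ʳ a , trans (sym (inverseʳ (τ T))) eq)
    ; cells-empty  = λ
        { (inj₁ (i , refl , _ , br , refl)) x (gap , gap′) →
            C-empty br (τ T ⟨$⟩ʳ x) (inColumn gap) gap′
        ; (inj₂ (i , e≡ , refl , _ , at , inj₁ (_ , min , refl))) x (gap , gap′) →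
            min-empty i e≡ at min (τ T ⟨$⟩ʳ x) (inColumn gap) gap′
        ; (inj₂ (i , e≡ , refl , _ , at , inj₂ (_ , max , refl))) x (gap , gap′) →
            max-empty i e≡ at max (τ T ⟨$⟩ʳ x) (inColumn gap) gap′ }
    }
    where
    open IsLabelOccurrence occ
    ν : Fin k → Fin n
    -- The vertex at place a in the preorder of P, sent to T by f and then replaced by its preorder
    -- position.
    ν a = τ T ⟨$⟩ˡ f (τ P ⟨$⟩ʳ a)
    ν-increasing : Monotonic₁ _<_ _<_ ν
    ν-increasing a<b = T.position-< (mono-≺ (P.mk≺
      (subst₂ _<_ (sym (inverseˡ (τ P))) (sym (inverseˡ (τ P))) a<b)))
    position : ∀ b → ν (τ P ⟨$⟩ˡ b) ≡ τ T ⟨$⟩ˡ f b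
    position b = cong (λ u → τ T ⟨$⟩ˡ f u) (inverseʳ (τ P))
    inColumn : ∀ {i x} → InGap ν (column P i) x → InColumn f i (τ T ⟨$⟩ʳ x)
    inColumn gap with inGap-inject₁⁻ ν ν-increasing gap
    ... | ν< , <ν =
        (λ b (P.mk≺ b<i) → T.mk≺ (subst₂ _<_ (position b) (sym (inverseˡ (τ T))) (ν< b<i)))
      , (λ b b⊀i → T.mk≺ (subst₂ _<_ (sym (inverseˡ (τ T))) (position b) (<ν (ℕ.≮⇒≥ (b⊀i ∘ P.mk≺)))))

  module _ {f : Fin k → Fin n}
           (childL : ∀ {p i} → LeftChild P p i → InL T (f p) (f i))
           (childR : ∀ {p i} → RightChild P p i → InR T (f p) (f i)) where

    -- Walking down P, each child lands on the correct side of its parent's image, and `L-below` and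
    -- `R-below` carry along everything under it.
    preserves-L : ∀ {p v} → InL P p v → InL T (f p) (f v)
    preserves-R : ∀ {p v} → InR P p v → InR T (f p) (f v)
    preserves-below : ∀ {p v} → P.Below p v → T.Below (f p) (f v)

    private
      goL : ∀ {l p r v} → node l p r ⊑ tree P → v ∈ᵛ l → InL T (f p) (f v)
      goR : ∀ {l p r v} → node l p r ⊑ tree P → v ∈ᵛ r → InR T (f p) (f v)
      go  : ∀ {l p r v} → node l p r ⊑ tree P → v ∈ᵛ node l p r → T.Below (f p) (f v)
      goL {node _ _ _} q v∈ = T.L-below (childL (_ , _ , _ , q)) (go (⊑-trans (left self) q) v∈)
      goR {r = node _ _ _} q v∈ = T.R-below (childR (_ , _ , _ , q)) (go (⊑-trans (right self) q) v∈)
      go q root       = inj₁ refl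
      go q (left v∈)  = inj₂ (inj₁ (goL q v∈))
      go q (right v∈) = inj₂ (inj₂ (goR q v∈))

    preserves-L (_ , _ , q , v∈) = goL q v∈
    preserves-R (_ , _ , q , v∈) = goR q v∈
    preserves-below (inj₁ refl)       = inj₁ refl
    preserves-below (inj₂ (inj₁ pLv)) = inj₂ (inj₁ (preserves-L pLv))
    preserves-below (inj₂ (inj₂ pRv)) = inj₂ (inj₂ (preserves-R pRv))

  -- Tree occurrences are label occurrences

  nonRoot : ∀ {p i} → p P.≺ i → ∃[ i′ ] value {P = λ j → rootOf (tree P) ≢ just j} i′ ≡ i
  nonRoot {i = i} p≺i = (i , [ P.≺⇒nonRoot p≺i ]) , refl

  tree⇒label : ∀ {f} → IsTreeOccurrence T pat f → IsLabelOccurrence f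
  tree⇒label {f} occ = record
    { mono-<    = mono-<
    ; mono-≺    = mono-≺
    ; C-empty   = C-empty
    -- For a right child i of p, all labels of P(i) exceed p, so both rows lie above f p; this is
    -- the fact passed to `child-empty`.
    ; min-empty = λ i e≡ at (m∈ , _) d col gap → child-empty i e≡ d col λ p∈ →
        proj₁ (inGap-inject₁⁻ f mono-< gap) (p<below p∈ (P.subtree-below at m∈))
    ; max-empty = λ i e≡ at (m∈ , _) d col gap → child-empty i e≡ d col λ p∈ →
        proj₁ (inGap⁻ f mono-< gap) (ℕ.m<n⇒m<1+n (p<below p∈ (P.subtree-below at m∈)))
    }
    where
    open IsTreeOccurrence occ
    childL : ∀ {p i} → LeftChild P p i → InL T (f p) (f i)
    childL {i = i} lc with nonRoot (P.L⇒≺ (P.leftChild⇒L lc))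
    ... | i′ , refl with proj₂ pat i′ in eq
    ...   | true  = T.leftChild⇒L (left₁ i′ lc eq)
    ...   | false = left₀ i′ lc eq
    childR : ∀ {p i} → RightChild P p i → InR T (f p) (f i)
    childR rc with nonRoot (P.R⇒≺ (P.rightChild⇒R rc))
    ... | i′ , refl with proj₂ pat i′ in eq
    ...   | true  = T.rightChild⇒R (right₁ i′ rc eq)
    ...   | false = right₀ i′ rc eq
    f-L : ∀ {p v} → InL P p v → InL T (f p) (f v)
    f-L = preserves-L childL childR
    f-R : ∀ {p v} → InR P p v → InR T (f p) (f v)
    f-R = preserves-R childL childR
    mono-< : ∀ {u w} → u < w → f u < f w
    mono-< u<w with P.<⇒relation u<w
    ... | inj₁ uRw                     = T.R⇒< (f-R uRw)
    ... | inj₂ (inj₁ wLu)              = T.L⇒< (f-L wLu)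
    ... | inj₂ (inj₂ (_ , cLu , cRw)) = <-trans (T.L⇒< (f-L cLu)) (T.R⇒< (f-R cRw))
    mono-≺ : ∀ {u w} → u P.≺ w → f u T.≺ f w
    mono-≺ u≺w with P.≺⇒Below⊎Split u≺w
    ... | inj₁ (inj₁ refl)       = contradiction u≺w P.≺-irrefl
    ... | inj₁ (inj₂ (inj₁ uLw)) = T.L⇒≺ (f-L uLw)
    ... | inj₁ (inj₂ (inj₂ uRw)) = T.R⇒≺ (f-R uRw)
    ... | inj₂ (_ , cLu , cRw)   = T.LR⇒≺ (f-L cLu) (f-R cRw)
    p<below : ∀ {p i m} → RightChild P p i → P.Below i m → p < m
    p<below rc b = P.R⇒< (P.R-below (P.rightChild⇒R rc) b)
    -- The row lies between f j and f c for the right child c of j, so convexity gives d ∈ R(f j)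
    -- and f j ≺ d; the column lies before f j because j is in P(i).
    C-empty : ∀ {i j} → InBR⁻ P i j → ∀ d → InColumn f i d → ¬ InGap f (suc j) d
    C-empty br d (_ , after) gap with P.BR⁻⇒below br | inGap⁻ f mono-< gap
    ... | i≼j , c , rc | f< , <f = T.≺-asym (after _ (P.below⇒⊀ i≼j))
      (T.R⇒≺ (T.R-convex (childR rc) (f< (ℕ.n<1+n _)) (<f (P.R⇒< (P.rightChild⇒R rc)))))
    -- The column of i lies between f p and f i in preorder. Nothing comes between a parent and its
    -- left child, and only labels below the parent come between it and its right child.
    child-empty : ∀ i → proj₂ pat i ≡ true → ∀ d → InColumn f (value i) d →
                  (∀ {p} → RightChild P p (value i) → f p < d) → ⊥
    child-empty i e≡ d (before , after) f< with P.parent i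
    ... | p , inj₁ lc = T.leftChild-adjacent (left₁ i lc e≡)
      (before p (P.L⇒≺ (P.leftChild⇒L lc))) (after _ P.≺-irrefl)
    ... | p , inj₂ rc = T.rightChild-adjacent (right₁ i rc e≡)
      (before p (P.R⇒≺ (P.rightChild⇒R rc))) (f< rc) (after _ P.≺-irrefl)

  -- Label occurrences are tree occurrences

  label⇒tree : ∀ {f} → IsLabelOccurrence f → IsTreeOccurrence T pat f
  label⇒tree {f} occ = record
    { injective = injective
    ; left₁     = leftChild
    ; right₁    = rightChild
    ; left₀     = λ _ lc _ → childL lc
    ; right₀    = λ _ rc _ → childR rc
    }
    where
    open IsLabelOccurrence occ
    mono-≤ : ∀ {u w} → u ≤ w → f u ≤ f w
    mono-≤ = mono⇒mono-≤ mono-<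
    injective : ∀ {u w} → f u ≡ f w → u ≡ w
    injective {u} {w} eq with <-cmp u w
    ... | tri< u<w _ _ = contradiction eq (<⇒≢ (mono-< u<w))
    ... | tri≈ _ u≡w _ = u≡w
    ... | tri> _ _ w<u = contradiction (sym eq) (<⇒≢ (mono-< w<u))
    mono-⊀ : ∀ {u w} → ¬ u P.≺ w → ¬ f u T.≺ f w
    mono-⊀ {u} {w} u⊀w fu≺fw with P.≺-cmp u w
    ... | inj₁ u≺w         = u⊀w u≺w
    ... | inj₂ (inj₁ refl) = T.≺-irrefl fu≺fw
    ... | inj₂ (inj₂ w≺u)  = T.≺-asym fu≺fw (mono-≺ w≺u)
    reflects-≺ : ∀ {u w} → f u T.≺ f w → u P.≺ w
    reflects-≺ {u} {w} fu≺fw with u P.≺? w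
    ... | yes u≺w = u≺w
    ... | no u⊀w  = contradiction fu≺fw (mono-⊀ u⊀w)
    f-L : ∀ {p v} → InL P p v → InL T (f p) (f v)
    f-L pLv = T.>∧≺⇒L (mono-< (P.L⇒< pLv)) (mono-≺ (P.L⇒≺ pLv))
    childL : ∀ {p i} → LeftChild P p i → InL T (f p) (f i)
    childL lc = f-L (P.leftChild⇒L lc)

    -- A vertex d separating f j from f c lies in the row between j and j + 1.  Let q be the first
    -- pattern vertex whose image comes after d; unless j lies on the right branch from q, so that
    -- the cell is shaded, the left subtree of some pattern vertex already determines the side of d.
    ¬split : ∀ {j c} → RightChild P j c → ¬ T.Split (f j) (f c)
    ¬split {j} {c} rc (d , dLj , dRc) with P.≺-least (λ b → d T.≺? f b) (T.L⇒≺ dLj)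
    ... | q , d≺fq , q-first = excluded (P.≺-cmp q j)
      where
      jRc = P.rightChild⇒R rc
      fj<d = T.L⇒< dLj
      d<fc = T.R⇒< dRc
      below-row : ∀ {b} → b ≤ j → f b < d
      below-row b≤j = ℕ.≤-<-trans (mono-≤ b≤j) fj<d
      -- A label strictly between j and c belongs to L(c), as c is the right child of j. If its
      -- image were at most d, then d ∈ L(f c) by convexity, and d would come after f c.
      above-row : ∀ {b} → j < b → d < f b
      above-row {b} j<b with ℕ.<-≤-connex (toℕ b) (toℕ c)
      ... | inj₂ c≤b = ℕ.<-≤-trans d<fc (mono-≤ c≤b)
      ... | inj₁ b<c with P.rightChild-below rc (P.R-convex jRc j<b b<c)
      ...   | inj₁ refl       = contradiction refl (<⇒≢ b<c)
      ...   | inj₂ (inj₂ cRb) = contradiction b<c (<-asym (P.R⇒< cRb))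
      ...   | inj₂ (inj₁ cLb) = ℕ.≰⇒> λ fb≤d →
        T.≺-asym (T.R⇒≺ dRc) (T.L⇒≺ (T.L-convex-≤ (f-L cLb) fb≤d d<fc))
      f≢d : ∀ b → f b ≢ d
      f≢d b fb≡d with ℕ.<-≤-connex (toℕ j) (toℕ b)
      ... | inj₁ j<b = <⇒≢ (above-row j<b) (sym fb≡d)
      ... | inj₂ b≤j = <⇒≢ (below-row b≤j) fb≡d
      before : ∀ b → b P.≺ q → f b T.≺ d
      before b b≺q with T.≺-cmp (f b) d
      ... | inj₁ fb≺d        = fb≺d
      ... | inj₂ (inj₁ fb≡d) = contradiction fb≡d (f≢d b)
      ... | inj₂ (inj₂ d≺fb) = contradiction d≺fb (q-first b≺q)
      after : ∀ b → ¬ b P.≺ q → d T.≺ f b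
      after b b⊀q = T.≺-⊀-trans d≺fq (mono-⊀ b⊀q)
      ¬below : ¬ P.Below q j
      ¬below qBj with P.below⇒BR⁻⊎L qBj rc
      ... | inj₁ br = C-empty br d (before , after)
        (inGap⁺ f (λ _ b<1+j → below-row (ℕ.s≤s⁻¹ b<1+j)) (λ _ → above-row))
      -- Here c ∈ L(x) as well, so f j < d < f c < f x gives d ∈ L(f x) and f x ≺ d, although x ∈
      -- P(q) forces d ≺ f x.
      ... | inj₂ (x , qBx , xLj) = T.≺-asym (after x (P.below⇒⊀ qBx))
        (T.L⇒≺ (T.L-convex (f-L xLj) fj<d
          (<-trans d<fc (T.L⇒< (f-L (P.L-below xLj (inj₂ (inj₂ jRc))))))))
      excluded : ¬ (q P.≺ j ⊎ q ≡ j ⊎ j P.≺ q)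
      excluded (inj₂ (inj₁ refl)) = ¬below (inj₁ refl)
      excluded (inj₂ (inj₂ j≺q))  = q-first j≺q (T.L⇒≺ dLj)
      excluded (inj₁ q≺j) with P.≺⇒Below⊎Split q≺j
      ... | inj₁ qBj             = ¬below qBj
      -- Now x ≺ q, so f x ≺ d ≺ f q; contiguity gives d ∈ L(f x), hence d < f x < f j.
      ... | inj₂ (x , xLq , xRj) = <-asym fj<d (<-trans
        (T.L⇒< (T.L-contiguous (f-L xLq) (before x (P.L⇒≺ xLq)) d≺fq)) (mono-< (P.R⇒< xRj)))

    childR : ∀ {p i} → RightChild P p i → InR T (f p) (f i)
    childR rc = [ (λ r → r) , (λ s → ⊥-elim (¬split rc s)) ]′
      (T.<∧≺⇒R⊎Split (mono-< (P.R⇒< (P.rightChild⇒R rc))) (mono-≺ (P.R⇒≺ (P.rightChild⇒R rc))))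
    f-below : ∀ {p v} → P.Below p v → T.Below (f p) (f v)
    f-below = preserves-below childL childR
    -- As i directly follows p, a vertex b before i is p or earlier, so f b is not after f p, which
    -- precedes c.
    leftColumn : ∀ {p i c} → LeftChild P p i → InL T (f p) c → c T.≺ f i → InColumn f i c
    leftColumn lc pLc c≺fi =
        (λ b b≺i → T.⊀-≺-trans (mono-⊀ λ p≺b → P.leftChild-adjacent lc p≺b b≺i) (T.L⇒≺ pLc))
      , (λ b b⊀i → T.≺-⊀-trans c≺fi (mono-⊀ b⊀i))
    -- Vertices of P strictly between p and i in preorder belong to L(p), and L(f p) precedes R(f
    -- p).
    rightColumn : ∀ {p i c} → RightChild P p i → InR T (f p) c → c T.≺ f i → InColumn f i c
    rightColumn {p} {i} {c} rc pRc c≺fi = before , λ b b⊀i → T.≺-⊀-trans c≺fi (mono-⊀ b⊀i)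
      where
      before : ∀ b → b P.≺ i → f b T.≺ c
      before b b≺i with p P.≺? b
      ... | no p⊀b = T.⊀-≺-trans (mono-⊀ p⊀b) (T.R⇒≺ pRc)
      ... | yes p≺b with <-cmp b p
      ...   | tri< b<p _ _  = T.LR⇒≺ (f-L (P.>∧≺⇒L b<p p≺b)) pRc
      ...   | tri≈ _ refl _ = contradiction p≺b P.≺-irrefl
      ...   | tri> _ _ p<b  = contradiction b≺i (P.rightChild-adjacent rc p≺b p<b)
    L⇒<max : ∀ {c i m} → InL T c (f i) → P.Below i m → ∀ {b} → b ≤ m → f b < c
    L⇒<max cLi iBm b≤m = ℕ.≤-<-trans (mono-≤ b≤m) (T.L⇒< (T.L-below cLi (f-below iBm)))
    R⇒min< : ∀ {c i m} → InR T c (f i) → P.Below i m → ∀ {b} → m ≤ b → c < f b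
    R⇒min< cRi iBm m≤b = ℕ.<-≤-trans (T.R⇒< (T.R-below cRi (f-below iBm))) (mono-≤ m≤b)

    -- Let c be the root of L(f p). If f i ∈ L(c), all images of P(i) are below c, which puts c in
    -- the cell at max P(i); if f i ∈ R(c), it lies in the cell at min P(i) - 1.
    leftChild : ∀ i {p} → LeftChild P p (value i) → proj₂ pat i ≡ true → LeftChild T (f p) (f (value i))
    leftChild i {p} lc e≡ with childL lc
    ... | node _ c _ , _ , q , root     = _ , _ , _ , q
    ... | node _ c _ , _ , q , left fi∈ = ⊥-elim (¬L (_ , _ , ⊑-trans (left self) q , fi∈))
      where
      pLc : InL T (f p) c
      pLc = _ , _ , q , root
      ¬L : ¬ InL T c (f (value i))
      ¬L cLi with P.below-max (value i)
      ... | s , m , at , max , iBm , ≤m = max-empty i e≡ at max c (leftColumn lc pLc (T.L⇒≺ cLi))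
        (inGap⁺ f (λ _ b<1+m → L⇒<max cLi iBm (ℕ.s≤s⁻¹ b<1+m))
          -- max P(i) is p - 1: a label between i and p belongs to P(i), so b > m means b ≥ p.
          λ b m<b → ℕ.<-≤-trans (T.L⇒< pLc) (mono-≤ (ℕ.≮⇒≥ λ b<p → ℕ.<⇒≱ m<b (≤m
            (P.leftChild-below lc (P.L-convex (P.leftChild⇒L lc) (ℕ.≤-<-trans (≤m (inj₁ refl)) m<b) b<p))))))
    ... | node _ c _ , _ , q , right fi∈ = ⊥-elim (¬R (_ , _ , ⊑-trans (left self) q , fi∈))
      where
      pLc : InL T (f p) c
      pLc = _ , _ , q , root
      ¬R : ¬ InR T c (f (value i))
      ¬R cRi with P.below-min (value i)
      ... | s , m , at , min , iBm , m≤ = min-empty i e≡ at min c (leftColumn lc pLc (T.R⇒≺ cRi))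
        (inGap-inject₁⁺ f
          -- Otherwise f b ∈ L(f p), so p ≺ b and b ∈ P(i), contrary to the minimality of m.
          (λ b b<m → ℕ.≰⇒> λ c≤fb →
            let b<p = <-trans (ℕ.<-≤-trans b<m (m≤ (inj₁ refl))) (P.L⇒< (P.leftChild⇒L lc))
                p≺b = reflects-≺ (T.L⇒≺ (T.L-convex-≤ pLc c≤fb (mono-< b<p)))
            in ℕ.<⇒≱ b<m (m≤ (P.leftChild-below lc (P.>∧≺⇒L b<p p≺b))))
          (λ _ → R⇒min< cRi iBm))

    rightChild : ∀ i {p} → RightChild P p (value i) → proj₂ pat i ≡ true → RightChild T (f p) (f (value i))
    rightChild i {p} rc e≡ with childR rc
    ... | _ , node _ c _ , q , root     = _ , _ , _ , q
    ... | _ , node _ c _ , q , left fi∈ = ⊥-elim (¬L (_ , _ , ⊑-trans (right self) q , fi∈))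
      where
      pRc : InR T (f p) c
      pRc = _ , _ , q , root
      ¬L : ¬ InL T c (f (value i))
      ¬L cLi with P.below-max (value i)
      ... | s , m , at , max , iBm , ≤m = max-empty i e≡ at max c (rightColumn rc pRc (T.L⇒≺ cLi))
        (inGap⁺ f (λ _ b<1+m → L⇒<max cLi iBm (ℕ.s≤s⁻¹ b<1+m)) (λ b m<b → ℕ.≰⇒> (c<f m<b)))
        where
        -- If f b ≤ c, convexity gives f b ∈ R(f p), so p ≺ b. Either b ∈ P(i), against the
        -- maximality of m, or x separates p from b, and then c < f x < f b.
        c<f : ∀ {b} → m < b → ¬ f b ≤ c
        c<f m<b fb≤c = [ (λ pRb → ℕ.<⇒≱ m<b (≤m (P.rightChild-below rc pRb)))
                       , (λ (_ , xLp , xRb) → ℕ.<⇒≱ (<-trans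
                           (T.L⇒< (T.L-below (f-L xLp) (inj₂ (inj₂ pRc)))) (mono-< (P.R⇒< xRb))) fb≤c)
                       ]′ (P.<∧≺⇒R⊎Split p<b (reflects-≺ (T.R⇒≺ (T.R-convex-≤ pRc (mono-< p<b) fb≤c))))
          where
          p<b = <-trans (P.R⇒< (P.rightChild⇒R rc)) (ℕ.≤-<-trans (≤m (inj₁ refl)) m<b)
    ... | _ , node _ c _ , q , right fi∈ = ⊥-elim (¬R (_ , _ , ⊑-trans (right self) q , fi∈))
      where
      pRc : InR T (f p) c
      pRc = _ , _ , q , root
      ¬R : ¬ InR T c (f (value i))
      ¬R cRi with P.below-min (value i)
      ... | s , m , at , min , iBm , m≤ = min-empty i e≡ at min c (rightColumn rc pRc (T.R⇒≺ cRi))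
        (inGap-inject₁⁺ f
          -- min P(i) is p + 1, so b < m means b ≤ p.
          (λ b b<m → ℕ.≤-<-trans (mono-≤ (ℕ.≮⇒≥ λ p<b → ℕ.<⇒≱ b<m (m≤ (P.rightChild-below rc
            (P.R-convex (P.rightChild⇒R rc) p<b (ℕ.<-≤-trans b<m (m≤ (inj₁ refl)))))))) (T.R⇒< pRc))
          (λ _ → R⇒min< cRi iBm))

  containsᵀ⇔containsᴹ : T Containsᵀ pat ⇔ τ T Containsᴹ σ pat
  containsᵀ⇔containsᴹ = mk⇔
    (λ (f , occ) → label⇒mesh (tree⇒label occ))
    (λ occ → let f , occ′ = mesh⇒label occ in f , label⇒tree occ′)

-- Preorder words and 231-avoidance

⊆-tabulate⁻ : ∀ {f : Fin n → A} {ys} → ys ⊆ tabulate f → ∃[ is ] AllPairs _<_ is × ys ≡ map f is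
⊆-tabulate⁻ {zero}  []       = [] , [] , refl
⊆-tabulate⁻ {suc n} (_ ∷ʳ p) with ⊆-tabulate⁻ p
... | is , is↑ , eq = map suc is , AllPairs.map⁺ (AllPairs.map s<s is↑) , trans eq (map-∘ is)
⊆-tabulate⁻ {suc n} (refl ∷ p) with ⊆-tabulate⁻ p
... | is , is↑ , eq = zero ∷ map suc is
                    , All.map⁺ (All.universal (λ _ → z<s) is) ∷ AllPairs.map⁺ (AllPairs.map s<s is↑)
                    , cong (_ ∷_) (trans eq (map-∘ is))

AllPairs-resp-⊆ : ∀ {R : Rel A 0ℓ} {xs ys} → xs ⊆ ys → AllPairs R ys → AllPairs R xs
AllPairs-resp-⊆ []         []         = []
AllPairs-resp-⊆ (_ ∷ʳ p)   (_ ∷ rs)   = AllPairs-resp-⊆ p rs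
AllPairs-resp-⊆ (refl ∷ p) (r ∷ rs)   = All-resp-⊆ p r ∷ AllPairs-resp-⊆ p rs

-- Phrased with sublists so that it passes to subwords in the recursion.
Avoids231 : List (Fin n) → Set
Avoids231 xs = ∀ {a b c} → (a ∷ b ∷ c ∷ []) ⊆ xs → c < a → ¬ a < b

containsᴹ-231 : ∀ (π : Permutation′ n) {i j k} → i < j → j < k →
                π ⟨$⟩ʳ k < π ⟨$⟩ʳ i → π ⟨$⟩ʳ i < π ⟨$⟩ʳ j → π Containsᴹ classical perm231
containsᴹ-231 {n} π {i} {j} {k} i<j j<k c<a a<b = record
  { ν            = ν
  ; ν-increasing = ν-increasing
  ; sameOrder    = sameOrder
  ; λ′           = λ′
  ; λ-increasing = λ-increasing
  ; λ-values     = λ v → mk⇔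
      (λ { (0F , eq) → 2F , eq ; (1F , eq) → 0F , eq ; (2F , eq) → 1F , eq })
      (λ { (0F , eq) → 1F , eq ; (1F , eq) → 2F , eq ; (2F , eq) → 0F , eq })
  ; cells-empty  = λ ()
  }
  where
  ν λ′ : Fin 3 → Fin n
  ν 0F = i
  ν 1F = j
  ν 2F = k
  λ′ 0F = π ⟨$⟩ʳ k
  λ′ 1F = π ⟨$⟩ʳ i
  λ′ 2F = π ⟨$⟩ʳ j
  increasing : ∀ {g : Fin 3 → Fin n} → g 0F < g 1F → g 1F < g 2F → Monotonic₁ _<_ _<_ g
  increasing p q {0F} {1F} _ = p
  increasing p q {0F} {2F} _ = <-trans p q
  increasing p q {1F} {2F} _ = q
  increasing p q {0F} {0F} ()
  increasing p q {1F} {0F} ()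
  increasing p q {1F} {1F} (s≤s ())
  increasing p q {2F} {0F} ()
  increasing p q {2F} {1F} (s≤s ())
  increasing p q {2F} {2F} (s≤s (s≤s ()))
  ν-increasing : Monotonic₁ _<_ _<_ ν
  ν-increasing = increasing i<j j<k
  λ-increasing : Monotonic₁ _<_ _<_ λ′
  λ-increasing = increasing c<a a<b
  π∘ν : ∀ a → π ⟨$⟩ʳ ν a ≡ λ′ (perm231 ⟨$⟩ʳ a)
  π∘ν 0F = refl
  π∘ν 1F = refl
  π∘ν 2F = refl
  sameOrder : ∀ a b → (perm231 ⟨$⟩ʳ a < perm231 ⟨$⟩ʳ b) ⇔ (π ⟨$⟩ʳ ν a < π ⟨$⟩ʳ ν b)
  sameOrder a b = mk⇔
    (λ lt → subst₂ _<_ (sym (π∘ν a)) (sym (π∘ν b)) (λ-increasing lt))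
    (λ lt → mono⇒reflects-< λ-increasing (subst₂ _<_ (π∘ν a) (π∘ν b) lt))

avoids231-tabulate : (π : Permutation′ n) → π Avoidsᴹ classical perm231 → Avoids231 (tabulate (π ⟨$⟩ʳ_))
avoids231-tabulate π av p c<a a<b with ⊆-tabulate⁻ p
... | i ∷ j ∷ k ∷ [] , (i<j ∷ _) ∷ (j<k ∷ _) ∷ _ , refl = av (containsᴹ-231 π i<j j<k c<a a<b)

-- For letters a, b, c in this order, c < a forces c ∈ L(a). As L(a) is contiguous in preorder, also
-- b ∈ L(a), so b < a.
τ-avoids231 : (T : 𝒯 n) → τ T Avoidsᴹ classical perm231
τ-avoids231 T occ =
  <-asym a<b (L⇒< (L-contiguous (>∧≺⇒L c<a (ordered z<s)) (ordered z<s) (ordered (s<s z<s))))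
  where
  open Order T
  open MeshOccurrence occ
  a<b : τ T ⟨$⟩ʳ ν 0F < τ T ⟨$⟩ʳ ν 1F
  a<b = Equivalence.to (sameOrder 0F 1F) (s<s z<s)
  c<a : τ T ⟨$⟩ʳ ν 2F < τ T ⟨$⟩ʳ ν 0F
  c<a = Equivalence.to (sameOrder 2F 0F) z<s
  ordered : ∀ {a b} → a < b → τ T ⟨$⟩ʳ ν a ≺ τ T ⟨$⟩ʳ ν b
  ordered a<b = mk≺ (subst₂ _<_ (sym (inverseˡ (τ T))) (sym (inverseˡ (τ T))) (ν-increasing a<b))

data Splits {n} (x : Fin n) : List (Fin n) → Set where
  splits : ∀ {l r} → All (_< x) l → All (x <_) r → Splits x (l ++ r)

-- In a word avoiding 231, no letter larger than the first one precedes a smaller one.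
split : ∀ {x : Fin n} {xs : List (Fin n)} → Unique (x ∷ xs) → Avoids231 (x ∷ xs) → Splits x xs
split {xs = []} _ _ = splits [] []
split {x = x} {y ∷ ys} ((x≢y ∷ x≢) ∷ _ ∷ uq) av with <-cmp x y
... | tri≈ _ x≡y _ = contradiction x≡y x≢y
... | tri< x<y _ _ = splits [] (x<y ∷ All.tabulate λ {z} z∈ → larger z∈ (<-cmp x z))
  where
  larger : ∀ {z} → z ∈ ys → _ → x < z
  larger _  (tri< x<z _ _)  = x<z
  larger z∈ (tri≈ _ x≡z _)  = contradiction x≡z (All.lookup x≢ z∈)
  larger z∈ (tri> _ _ z<x)  = contradiction x<y (av (refl ∷ refl ∷ from∈ z∈) z<x)
... | tri> _ _ y<x with split (x≢ ∷ uq) (λ p → av (⊆-trans p (refl ∷ (_ ∷ʳ ⊆-refl))))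
...   | splits l< <r = splits (y<x ∷ l<) <r

-- The cut lies directly before the first letter above x, or at the end.
++-unique : ∀ {x : Fin n} {l r l′ r′ : List (Fin n)} → All (_< x) l → All (x <_) r → All (_< x) l′ → All (x <_) r′ →
            l ++ r ≡ l′ ++ r′ → l ≡ l′ × r ≡ r′
++-unique [] _ [] _ eq = refl , eq
++-unique [] (x<y ∷ _) (y<x ∷ _) _ refl = contradiction x<y (<-asym y<x)
++-unique (y<x ∷ _) _ [] (x<y ∷ _) refl = contradiction x<y (<-asym y<x)
++-unique (_ ∷ l<) <r (_ ∷ l′<) <r′ eq with ∷-injective eq
... | refl , eq′ with ++-unique l< <r l′< <r′ eq′
...   | refl , refl = refl , refl

preorder-bounds : ∀ {l r : BinTree (Fin n)} {i} → IsSearchTree (node l i r) →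
                  All (_< i) (preorder l) × All (i <_) (preorder r)
preorder-bounds {l = l} {r} st = All.tabulate (proj₁ (st self) ∘ ∈-preorder⁻ l)
                               , All.tabulate (proj₂ (st self) ∘ ∈-preorder⁻ r)

preorder-injective : ∀ (s t : BinTree (Fin n)) → IsSearchTree s → IsSearchTree t →
                     preorder s ≡ preorder t → s ≡ t
preorder-injective ε ε _ _ _ = refl
preorder-injective (node l i r) (node l′ i′ r′) st st′ eq with ∷-injective eq
... | refl , eq′ with ++-unique (proj₁ (preorder-bounds st)) (proj₂ (preorder-bounds st))
                                (proj₁ (preorder-bounds st′)) (proj₂ (preorder-bounds st′)) eq′
...   | eql , eqr = cong₂ (λ l r → node l i r)
        (preorder-injective l l′ (st ∘ left) (st′ ∘ left) eql)
        (preorder-injective r r′ (st ∘ right) (st′ ∘ right) eqr)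

isSearchTree-node : ∀ {l r : BinTree (Fin n)} {i} → IsSearchTree l → IsSearchTree r →
                    All (_< i) (preorder l) → All (i <_) (preorder r) → IsSearchTree (node l i r)
isSearchTree-node stl str l< <r self      = All.lookup l< ∘ ∈-preorder⁺ , All.lookup <r ∘ ∈-preorder⁺
isSearchTree-node stl str l< <r (left p)  = stl p
isSearchTree-node stl str l< <r (right p) = str p

preorder-surjective : ∀ (xs : List (Fin n)) → Unique xs → Avoids231 xs →
                      ∃[ t ] IsSearchTree t × preorder t ≡ xs
preorder-surjective xs = build (length xs) xs ℕ.≤-refl
  where
  -- The pieces l and r are not subterms of the word, so the recursion runs on a bound m for the
  -- length.
  build : ∀ m xs → length xs ℕ.≤ m → Unique xs → Avoids231 xs → ∃[ t ] IsSearchTree t × preorder t ≡ xs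
  build _ [] _ _ _ = ε , (λ ()) , refl
  build (suc m) (x ∷ _) (s≤s len) uq@(_ ∷ uq′) av with split uq av
  ... | splits {l} {r} l< <r
    with build m l (ℕ.≤-trans (ℕ.≤-trans (ℕ.m≤m+n _ _) (ℕ.≤-reflexive (sym (length-++ l)))) len)
           (AllPairs-resp-⊆ (++⁺ʳ r ⊆-refl) uq′) (λ p → av (_ ∷ʳ ++⁺ʳ r p))
       | build m r (ℕ.≤-trans (ℕ.≤-trans (ℕ.m≤n+m _ _) (ℕ.≤-reflexive (sym (length-++ l)))) len)
           (AllPairs-resp-⊆ (++⁺ˡ l ⊆-refl) uq′) (λ p → av (_ ∷ʳ ++⁺ˡ l p))
  ...   | tl , stl , refl | tr , str , refl = node tl x tr , isSearchTree-node stl str l< <r , refl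

-- The preorder map to permutations

tabulate-τ : (T : 𝒯 n) → tabulate (τ T ⟨$⟩ʳ_) ≡ preorder (tree T)
tabulate-τ T = go (preorder (tree T)) (length-word T)
  where
  -- With the length generalised to m, `eq` can be matched with `refl`, which leaves a trivial
  -- `cast`.
  go : ∀ {m} (xs : List A) (eq : length xs ≡ m) → tabulate (lookup xs ∘ cast (sym eq)) ≡ xs
  go xs refl = trans (tabulate-cong (cong (lookup xs) ∘ cast-is-id refl)) (tabulate-lookup xs)

τ-cong : {T U : 𝒯 n} → T ≈ᵀ U → τ T ≈ τ U
τ-cong {n} {T} {U} eq i = go (length-word T) (length-word U) eq
  where
  go : ∀ {xs ys : BinTree (Fin n)} (p : length (preorder xs) ≡ n) (q : length (preorder ys) ≡ n) → xs ≡ ys →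
       lookup (preorder xs) (cast (sym p) i) ≡ lookup (preorder ys) (cast (sym q) i)
  go p q refl = refl

τ-injective : {T U : 𝒯 n} → τ T ≈ τ U → T ≈ᵀ U
τ-injective {T = T} {U} eq = preorder-injective (tree T) (tree U) (isSearchTree T) (isSearchTree U)
  (trans (sym (tabulate-τ T)) (trans (tabulate-cong eq) (tabulate-τ U)))

τ-surjective : (π : Permutation′ n) → π Avoidsᴹ classical perm231 → ∃[ T ] τ T ≈ π
τ-surjective {n} π av with preorder-surjective (tabulate (π ⟨$⟩ʳ_))
  (Unique.tabulate⁺ λ {i} {j} eq → trans (sym (inverseˡ π)) (trans (cong (π ⟨$⟩ˡ_) eq) (inverseˡ π)))
  (avoids231-tabulate π av)
... | t , st , eq = T , λ i → tabulate-injective (trans (tabulate-τ T) eq) i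
  where
  T : 𝒯 n
  T = record { tree = t ; isSearchTree = st
             ; size = trans (sym (length-preorder t)) (trans (cong length eq) (length-tabulate _)) }
  tabulate-injective : ∀ {m} {f g : Fin m → A} → tabulate f ≡ tabulate g → ∀ i → f i ≡ g i
  tabulate-injective eq zero    = proj₁ (∷-injective eq)
  tabulate-injective eq (suc i) = tabulate-injective (proj₂ (∷-injective eq)) i

-- Permutations are compared pointwise by `≈`, so containment is carried over field by field instead
-- of by substitution.
containsᴹ-resp-≈ : ∀ {π ρ : Permutation′ n} {m : MeshPattern k} → π ≈ ρ → π Containsᴹ m → ρ Containsᴹ m
containsᴹ-resp-≈ {π = π} {ρ} π≈ρ occ = record
  { ν            = ν
  ; ν-increasing = ν-increasing
  ; sameOrder    = λ a b → subst₂ (λ x y → _ ⇔ (x < y)) (π≈ρ (ν a)) (π≈ρ (ν b)) (sameOrder a b)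
  ; λ′           = λ′
  ; λ-increasing = λ-increasing
  ; λ-values     = λ v → mk⇔
      (λ j → let a , eq = Equivalence.to (λ-values v) j in a , trans (sym (π≈ρ _)) eq)
      (λ (a , eq) → Equivalence.from (λ-values v) (a , trans (π≈ρ _) eq))
  ; cells-empty  = λ {_} {j} c x (gap , gap′) →
      cells-empty c x (gap , subst (InGap λ′ j) (sym (π≈ρ x)) gap′)
  }
  where open MeshOccurrence occ

theorem2 : ∀ {k : ℕ} (pat : TreePattern k) (n : ℕ) →
    RestrictsToBijection _≈ᵀ_ _≈_ τ (𝒯-avoiding n pat) (S-avoiding-231-and n (σ pat))
theorem2 pat n = (λ {T} av → τ-avoids231 T , av ∘ Equivalence.from (containsᵀ⇔containsᴹ pat T)) , record
  { isInjection = record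
    { isCongruent = record
      { cong           = λ {(T , _)} {(U , _)} → τ-cong {T = T} {U}
      ; isEquivalence₁ = record { refl = refl ; sym = sym ; trans = trans }
      ; isEquivalence₂ = record
        { refl  = λ _ → refl
        ; sym   = λ eq i → sym (eq i)
        ; trans = λ eq eq′ i → trans (eq i) (eq′ i) }
      }
    ; injective = λ {(T , _)} {(U , _)} → τ-injective {T = T} {U}
    }
  -- `τ T` agrees with π pointwise, so avoidance of `σ pat` passes from π to `τ T`, and from there
  -- to avoidance of `pat` by T.
  ; surjective = λ (π , av231 , av) → let T , τT≈π = τ-surjective π av231 in
      (T , λ occ → av (containsᴹ-resp-≈ {π = τ T} τT≈π (Equivalence.to (containsᵀ⇔containsᴹ pat T) occ)))
    , λ {(U , _)} U≈T i → trans (τ-cong {T = U} {T} U≈T i) (τT≈π i)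
  }
  where open Occurrences
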